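{- There is a one-sided property testing algorithm for $k$-edge connectivity of directed graphs in the unbounded-degree model with false-reject probability at most $\tfrac13$ that performs $O\big(\tfrac{k^5}{(\epsilon\overline d)^3}\big)$ many queries.
   Context: $G=(V,E)$ is a directed graph with $n$ vertices and $m$ edges; $\overline d=m/n$. Queries are incidence-list queries: the $i$-th outgoing or $i$-th incoming edge of a vertex ($\bot$ if none). A graph is $k$-edge connected if it is strongly connected whenever fewer than $k$ edges are removed. Unbounded-degree model: $G$ is $\epsilon$-far from $k$-edge connectivity if more than $\epsilon n\overline d$ edge modifications are needed to make it $k$-edge connected. A property testing algorithm knows $n$, $m$, is given $\epsilon,k$, and with probability at least $\tfrac23$ accepts every graph with the property and rejects every graph $\epsilon$-far from it; one-sided means graphs with the property are always accepted. -}

module Defs where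

open import Data.Nat as ℕ using (ℕ; zero; suc; _⊔_)
open import Data.Fin using (Fin; zero; suc)
open import Data.Bool using (Bool; true; false; if_then_else_; not; _∧_)
open import Data.Maybe using (Maybe; just; nothing)
open import Data.List using (List; []; _∷_; length)
open import Data.List.Membership.Propositional using (_∈_)
open import Data.List.Relation.Unary.Unique.Propositional using (Unique)
open import Data.Product using (_×_; Σ; _,_)
open import Data.Integer using (+_)
open import Data.Rational as ℚ using (ℚ; 0ℚ; 1ℚ; _/_)
open import Function.Bundles using (_⇔_)
open import Relation.Binary.PropositionalEquality using (_≡_)

sumℕ : (r : ℕ) → (Fin r → ℕ) → ℕ
sumℕ zero    f = 0
sumℕ (suc r) f = f zero ℕ.+ sumℕ r (λ i → f (suc i))

sumℚ : (r : ℕ) → (Fin r → ℚ) → ℚ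
sumℚ zero    f = 0ℚ
sumℚ (suc r) f = f zero ℚ.+ sumℚ r (λ i → f (suc i))

maxℕ : (r : ℕ) → (Fin r → ℕ) → ℕ
maxℕ zero    f = 0
maxℕ (suc r) f = f zero ⊔ maxℕ r (λ i → f (suc i))

ℕtoℚ : ℕ → ℚ
ℕtoℚ k = (+ k) / 1

EdgeRel : ℕ → Set
EdgeRel n = Fin n → Fin n → Bool

b2n : Bool → ℕ
b2n true  = 1
b2n false = 0

edgeCount : ∀ {n} → EdgeRel n → ℕ
edgeCount {n} E = sumℕ n (λ u → sumℕ n (λ v → b2n (E u v)))

Loopless : ∀ {n} → EdgeRel n → Set
Loopless {n} E = (v : Fin n) → E v v ≡ false

data Reach {n : ℕ} (E : EdgeRel n) : Fin n → Fin n → Set where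
  here : ∀ {u} → Reach E u u
  step : ∀ {u v w} → E u v ≡ true → Reach E v w → Reach E u w

StronglyConnected : ∀ {n} → EdgeRel n → Set
StronglyConnected {n} E = (u v : Fin n) → Reach E u v

removeEdges : ∀ {n} → EdgeRel n → EdgeRel n → EdgeRel n
removeEdges E F u v = E u v ∧ not (F u v)

-- k-edge connected: strongly connected whenever fewer than k edges are removed
-- (F ranges over all sets of fewer than k vertex pairs; pairs that are not
-- edges of E have no effect).
KEdgeConnected : ∀ {n} → ℕ → EdgeRel n → Set
KEdgeConnected {n} k E =
  (F : EdgeRel n) → edgeCount F ℕ.< k → StronglyConnected (removeEdges E F)

xorB : Bool → Bool → Bool
xorB a b = if a then not b else b

editDist : ∀ {n} → EdgeRel n → EdgeRel n → ℕ
editDist {n} E E' = sumℕ n (λ u → sumℕ n (λ v → b2n (xorB (E u v) (E' u v))))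

-- ε-far from k-edge connectivity: more than ε·n·d̄ = ε·m modifications are
-- needed to make E a k-edge connected (simple) digraph
EpsFar : ∀ {n} → ℚ → ℕ → EdgeRel n → Set
EpsFar {n} ε k E =
  (E' : EdgeRel n) → Loopless E' → KEdgeConnected k E' →
  ε ℚ.* ℕtoℚ (edgeCount E) ℚ.< ℕtoℚ (editDist E E')

nth : ∀ {A : Set} → List A → ℕ → Maybe A
nth []       _       = nothing
nth (x ∷ xs) zero    = just x
nth (x ∷ xs) (suc i) = nth xs i

record Digraph (n : ℕ) : Set where
  field
    adj          : EdgeRel n
    loopless     : Loopless adj
    outList      : Fin n → List (Fin n)
    inList       : Fin n → List (Fin n)
    outUnique    : (v : Fin n) → Unique (outList v)
    inUnique     : (v : Fin n) → Unique (inList v)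
    outComplete  : (v w : Fin n) → (w ∈ outList v) ⇔ (adj v w ≡ true)
    inComplete   : (v w : Fin n) → (w ∈ inList v) ⇔ (adj w v ≡ true)

open Digraph public

-- Randomized query algorithms as randomized decision trees.
-- rand r f : choose i ∈ Fin (suc r) uniformly at random, continue with f i.
-- qOut v i f / qIn v i f : query the i-th (0-based) outgoing / incoming edge
-- of v; answer is the other endpoint, or nothing (⊥) if there is none.

data Tree (n : ℕ) : Set where
  accept reject : Tree n
  rand : (r : ℕ) → (Fin (suc r) → Tree n) → Tree n
  qOut : Fin n → ℕ → (Maybe (Fin n) → Tree n) → Tree n
  qIn  : Fin n → ℕ → (Maybe (Fin n) → Tree n) → Tree n

acceptProb : ∀ {n} → Digraph n → Tree n → ℚ
acceptProb G accept     = 1ℚ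
acceptProb G reject     = 0ℚ
acceptProb G (rand r f) =
  sumℚ (suc r) (λ i → acceptProb G (f i)) ℚ.* ((+ 1) / suc r)
acceptProb G (qOut v i f) = acceptProb G (f (nth (outList G v) i))
acceptProb G (qIn v i f)  = acceptProb G (f (nth (inList G v) i))

queries : ∀ {n} → Tree n → ℕ
queries accept           = 0
queries reject           = 0
queries (rand r f)       = maxℕ (suc r) (λ i → queries (f i))
queries {n} (qOut v i f) = suc (queries (f nothing) ⊔ maxℕ n (λ w → queries (f (just w))))
queries {n} (qIn v i f)  = suc (queries (f nothing) ⊔ maxℕ n (λ w → queries (f (just w))))

-- A digraph is k-edge connected iff every cut has at least k edges, so the
-- tester looks for a vertex set X with fewer than k leaving (or, in the
-- transposed graph, entering) edges; such an X is a certificate, which makes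
-- the error one-sided.
--
-- A far graph has many vertices in small such sets.  Fix a hub of k + 1 vertices
-- and add a minimal set of edges into the hub so that at least k edges leave
-- every set avoiding it.  Each added edge leaves a tight set; tight sets can be
-- uncrossed, so disjoint ones cover all added edges, and each carries at most k
-- of them.  Only few of these sets can be larger than s, so if few vertices lay
-- in sets of size at most s, then few edges would make the graph k-edge connected.
--
-- From a vertex v of a violating set X of size at most s, X is found as follows.
-- Keep the least set U containing v that minimises (known leaving edges) +
-- (sinks inside).  If U is small, open a vertex of U; once all of U is open, U is
-- a certificate.  If |U| ≥ 2ks, make a random vertex of U a sink: it lies in X
-- with probability at most 1/(2k), and the minimum grows by one.  When the
-- minimum reaches k, some sink lies in X, which has probability at most 1/2.
-- This costs O(k² s²) queries; O(s) repetitions with s = O(k n/(ε m)) suffice.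
-- If s ≤ k, a small violating set contains a vertex of outdegree below k, and
-- testing degrees is enough; if ε m = O(k²), the whole graph can be read.
module Submission where

open import Defs

-- Submodularity of the cut function is used twice. In the augmentation the intersection of two
-- meeting tight sets still has at least `k` leaving edges, so their union is tight. In the search,
-- sets attaining the minimum are closed under intersection, so the least one lies in all of them:
-- opening one of its vertices makes progress in every minimiser at once, and turning it into a sink
-- raises the minimum itself. This is why `U` has to be least.
--
-- The query bound has the form queries · (ε m)³ ≤ C k⁵ n³. It therefore permits no query at all
-- when ε m is large compared with k and n, or when k = 0 and ε m > 0, and such cases need an answer
-- without looking at the graph. In the main case 2s rounds of tests with O(k² s²) queries each cost
-- O(k² s³), and s = O(k n/(ε m)) turns this into k⁵ n³/(ε m)³ = k⁵/(ε d̄)³.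
--
-- Almost all estimates stay in the natural numbers: ε m is carried as a fraction a / b, and a bound
-- on a probability p is stated as c · p ≤ t with natural c and t.

-- Finite sums and Boolean case checks

module Sums where

  open import Data.Nat
  open import Data.Nat.Properties
  open import Data.Nat.Tactic.RingSolver using (solve-∀)
  open import Data.Bool using (Bool; true; false; _∧_; not)
  open import Data.Fin using (Fin; zero; suc)
  open import Data.Product using (∃; _×_; _,_)
  open import Function using (_∘_)
  open import Relation.Binary.PropositionalEquality
  open import Relation.Nullary using (Dec; ¬_)
  open import Relation.Nullary.Decidable using (map′; _×-dec_)

  infix 4 _⊑_
  _⊑_ : ∀ {n} → (Fin n → ℕ) → (Fin n → ℕ) → Set
  f ⊑ g = ∀ i → f i ≤ g i

  sum-cong : ∀ n {f g : Fin n → ℕ} → (∀ i → f i ≡ g i) → sumℕ n f ≡ sumℕ n g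
  sum-cong zero    f≡g = refl
  sum-cong (suc n) f≡g = cong₂ _+_ (f≡g zero) (sum-cong n (f≡g ∘ suc))

  sum-mono : ∀ n {f g : Fin n → ℕ} → f ⊑ g → sumℕ n f ≤ sumℕ n g
  sum-mono zero    f≤g = z≤n
  sum-mono (suc n) f≤g = +-mono-≤ (f≤g zero) (sum-mono n (f≤g ∘ suc))

  sum-mono-< : ∀ n {f g : Fin n → ℕ} → f ⊑ g → ∀ i → f i < g i → sumℕ n f < sumℕ n g
  sum-mono-< (suc n) f≤g zero    f<g = +-mono-<-≤ f<g (sum-mono n (f≤g ∘ suc))
  sum-mono-< (suc n) f≤g (suc i) f<g = +-mono-≤-< (f≤g zero) (sum-mono-< n (f≤g ∘ suc) i f<g)

  sum-mono-but-one : ∀ n {f g : Fin n → ℕ} c i → (∀ j → ¬ j ≡ i → f j ≤ g j) →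
    f i ≤ c + g i → sumℕ n f ≤ c + sumℕ n g
  sum-mono-but-one (suc n) {f} {g} c zero rest at-i = begin
    f zero + sumℕ n (f ∘ suc)       ≤⟨ +-mono-≤ at-i (sum-mono n λ j → rest (suc j) λ ()) ⟩
    c + g zero + sumℕ n (g ∘ suc)   ≡⟨ +-assoc c _ _ ⟩
    c + (g zero + sumℕ n (g ∘ suc)) ∎
    where open ≤-Reasoning
  sum-mono-but-one (suc n) {f} {g} c (suc i) rest at-i = begin
    f zero + sumℕ n (f ∘ suc)       ≤⟨ +-mono-≤ (rest zero λ ())
      (sum-mono-but-one n c i (λ j j≢i → rest (suc j) λ { refl → j≢i refl }) at-i) ⟩
    g zero + (c + sumℕ n (g ∘ suc)) ≡⟨ swap (g zero) c _ ⟩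
    c + (g zero + sumℕ n (g ∘ suc)) ∎
    where
    open ≤-Reasoning
    swap : ∀ a b c → a + (b + c) ≡ b + (a + c)
    swap = solve-∀

  sum-+ : ∀ n (f g : Fin n → ℕ) → sumℕ n (λ i → f i + g i) ≡ sumℕ n f + sumℕ n g
  sum-+ zero    f g = refl
  sum-+ (suc n) f g = trans (cong (f zero + g zero +_) (sum-+ n (f ∘ suc) (g ∘ suc)))
    (interchange (f zero) (g zero) _ _)
    where
    interchange : ∀ a b c d → a + b + (c + d) ≡ a + c + (b + d)
    interchange = solve-∀

  sum-zero : ∀ n → sumℕ n (λ _ → 0) ≡ 0
  sum-zero zero    = refl
  sum-zero (suc n) = sum-zero n

  sum-const : ∀ n c → sumℕ n (λ _ → c) ≡ n * c
  sum-const zero    c = refl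
  sum-const (suc n) c = cong (c +_) (sum-const n c)

  sum-*ˡ : ∀ n c (f : Fin n → ℕ) → sumℕ n (λ i → c * f i) ≡ c * sumℕ n f
  sum-*ˡ zero    c f = sym (*-zeroʳ c)
  sum-*ˡ (suc n) c f = trans (cong (c * f zero +_) (sum-*ˡ n c (f ∘ suc)))
    (sym (*-distribˡ-+ c (f zero) _))

  sum-*ʳ : ∀ n c (f : Fin n → ℕ) → sumℕ n (λ i → f i * c) ≡ sumℕ n f * c
  sum-*ʳ n c f = trans (sum-cong n λ i → *-comm (f i) c) (trans (sum-*ˡ n c f) (*-comm c _))

  sum-swap : ∀ m n (f : Fin m → Fin n → ℕ) →
    sumℕ m (λ i → sumℕ n (f i)) ≡ sumℕ n (λ j → sumℕ m (λ i → f i j))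
  sum-swap zero    n f = sym (sum-zero n)
  sum-swap (suc m) n f = trans (cong (sumℕ n (f zero) +_) (sum-swap m n (f ∘ suc)))
    (sym (sum-+ n (f zero) _))

  term≤sum : ∀ n (f : Fin n → ℕ) i → f i ≤ sumℕ n f
  term≤sum (suc n) f zero    = m≤m+n _ _
  term≤sum (suc n) f (suc i) = ≤-trans (term≤sum n (f ∘ suc) i) (m≤n+m _ _)

  sum-positive : ∀ n (f : Fin n → ℕ) → 0 < sumℕ n f → ∃ λ i → 0 < f i
  sum-positive (suc n) f pos with f zero in eq
  ... | suc m = zero , subst (0 <_) (sym eq) z<s
  ... | zero with sum-positive n (f ∘ suc) pos
  ...   | i , p = suc i , p

  sum² : ∀ n → (Fin n → Fin n → ℕ) → ℕ
  sum² n f = sumℕ n λ u → sumℕ n (f u)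

  sum²-mono : ∀ n {f g : Fin n → Fin n → ℕ} → (∀ u w → f u w ≤ g u w) → sum² n f ≤ sum² n g
  sum²-mono n f≤g = sum-mono n λ u → sum-mono n (f≤g u)

  sum²-cong : ∀ n {f g : Fin n → Fin n → ℕ} → (∀ u w → f u w ≡ g u w) → sum² n f ≡ sum² n g
  sum²-cong n f≡g = sum-cong n λ u → sum-cong n (f≡g u)

  sum²-mono-but-one : ∀ n {f g : Fin n → Fin n → ℕ} c u₀ w₀ →
    (∀ u w → ¬ (u ≡ u₀ × w ≡ w₀) → f u w ≤ g u w) →
    f u₀ w₀ ≤ c + g u₀ w₀ → sum² n f ≤ c + sum² n g
  sum²-mono-but-one n c u₀ w₀ rest at =
    sum-mono-but-one n c u₀
      (λ u u≢ → sum-mono n λ w → rest u w λ (u≡ , _) → u≢ u≡)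
      (sum-mono-but-one n c w₀ (λ w w≢ → rest u₀ w λ (_ , w≡) → w≢ w≡) at)

  sum²-+ : ∀ n (f g : Fin n → Fin n → ℕ) →
    sum² n (λ u w → f u w + g u w) ≡ sum² n f + sum² n g
  sum²-+ n f g = trans (sum-cong n λ u → sum-+ n (f u) (g u)) (sum-+ n _ _)

  sum²-product : ∀ n (f g : Fin n → ℕ) →
    sum² n (λ u w → f u * g w) ≡ sumℕ n f * sumℕ n g
  sum²-product n f g = trans (sum-cong n λ u → sum-*ˡ n (f u) g) (sum-*ʳ n _ f)

  b2n≤1 : ∀ b → b2n b ≤ 1
  b2n≤1 true  = ≤-refl
  b2n≤1 false = z≤n

  b2n-mono : ∀ {a b} → (a ≡ true → b ≡ true) → b2n a ≤ b2n b
  b2n-mono {false}         _ = z≤n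
  b2n-mono {true}  a⇒b rewrite a⇒b refl = ≤-refl

  b2n-true : ∀ {b} → 0 < b2n b → b ≡ true
  b2n-true {true} _ = refl

  -- Edgewise facts about memberships are finite Boolean statements; with this they are proved by
  -- evaluating a decision procedure through `toWitness`.
  ∀Bool? : ∀ {P : Bool → Set} → (∀ b → Dec (P b)) → Dec (∀ b → P b)
  ∀Bool? P? = map′ (λ { (t , f) true → t ; (t , f) false → f }) (λ p → p true , p false)
    (P? true ×-dec P? false)

  ∧-trueˡ : ∀ {a b} → a ∧ b ≡ true → a ≡ true
  ∧-trueˡ {true} _ = refl

  ∧-trueʳ : ∀ {a b} → a ∧ b ≡ true → b ≡ true
  ∧-trueʳ {true} eq = eq

  not-true : ∀ {a} → not a ≡ true → a ≡ false
  not-true {false} _ = refl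

  true≢false : true ≡ false → ∀ {A : Set} → A
  true≢false ()

-- Cuts, submodularity, and connectivity as a condition on cuts

module Cuts where

  open Sums
  open import Data.Nat
  open import Data.Nat.Properties
  open import Data.Bool using (Bool; true; false; _∧_; _∨_; not)
  open import Data.Bool.Properties using (¬-not) renaming (_≟_ to _≟ᵇ_)
  open import Data.Empty using (⊥-elim)
  open import Data.Fin using (Fin; zero; suc)
  import Data.Fin.Properties as Fin
  open import Data.Fin.Subset using (Subset; _∩_; _∪_; ∁) renaming (⊥ to ∅)
  open import Data.Fin.Subset.Properties using (anySubset?)
  open import Data.Product using (∃; _×_; _,_)
  open import Data.Vec using (lookup; _[_]≔_)
  open import Data.Vec.Properties using (lookup-zipWith; lookup-map; lookup-replicate; lookup∘update; lookup∘update′)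
  open import Relation.Binary.PropositionalEquality
  open import Relation.Nullary using (Dec; yes; no)
  open import Relation.Nullary.Decidable using (_×-dec_; _→-dec_; toWitness; decidable-stable)

  infix 9 _!_
  _!_ : ∀ {n} → Subset n → Fin n → Bool
  _!_ = lookup

  ∩-! : ∀ {n} (X Y : Subset n) u → (X ∩ Y) ! u ≡ X ! u ∧ Y ! u
  ∩-! X Y u = lookup-zipWith _∧_ u X Y

  ∪-! : ∀ {n} (X Y : Subset n) u → (X ∪ Y) ! u ≡ X ! u ∨ Y ! u
  ∪-! X Y u = lookup-zipWith _∨_ u X Y

  ∁-! : ∀ {n} (X : Subset n) u → ∁ X ! u ≡ not (X ! u)
  ∁-! X u = lookup-map u not X

  ∅-! : ∀ {n} (u : Fin n) → ∅ ! u ≡ false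
  ∅-! u = lookup-replicate u false

  ∪-introˡ : ∀ {n} (X Y : Subset n) u → X ! u ≡ true → (X ∪ Y) ! u ≡ true
  ∪-introˡ X Y u u∈X rewrite ∪-! X Y u | u∈X = refl

  ∪-introʳ : ∀ {n} (X Y : Subset n) u → Y ! u ≡ true → (X ∪ Y) ! u ≡ true
  ∪-introʳ X Y u u∈Y rewrite ∪-! X Y u | u∈Y with X ! u
  ... | true  = refl
  ... | false = refl

  ∩-intro : ∀ {n} (X Y : Subset n) u → X ! u ≡ true → Y ! u ≡ true → (X ∩ Y) ! u ≡ true
  ∩-intro X Y u u∈X u∈Y rewrite ∩-! X Y u | u∈X | u∈Y = refl

  ∩-elimˡ : ∀ {n} (X Y : Subset n) u → (X ∩ Y) ! u ≡ true → X ! u ≡ true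
  ∩-elimˡ X Y u u∈ rewrite ∩-! X Y u = ∧-trueˡ u∈

  ∩-elimʳ : ∀ {n} (X Y : Subset n) u → (X ∩ Y) ! u ≡ true → Y ! u ≡ true
  ∩-elimʳ X Y u u∈ rewrite ∩-! X Y u = ∧-trueʳ {X ! u} u∈

  ∪-false : ∀ {n} (X Y : Subset n) u → X ! u ≡ false → Y ! u ≡ false → (X ∪ Y) ! u ≡ false
  ∪-false X Y u u∉X u∉Y rewrite ∪-! X Y u | u∉X | u∉Y = refl

  size : ∀ {n} → Subset n → ℕ
  size {n} X = sumℕ n λ u → b2n (X ! u)

  size≤n : ∀ {n} (X : Subset n) → size X ≤ n
  size≤n {n} X = subst (size X ≤_) (trans (sum-const n 1) (*-identityʳ n)) (sum-mono n λ u → b2n≤1 (X ! u))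

  size-mono-< : ∀ {n} {X Y : Subset n} → (∀ u → X ! u ≡ true → Y ! u ≡ true) →
    ∀ u → X ! u ≡ false → Y ! u ≡ true → size X < size Y
  size-mono-< {n} X⊆Y u u∉X u∈Y = sum-mono-< n (λ u → b2n-mono (X⊆Y u)) u
    (subst₂ (λ a b → b2n a < b2n b) (sym u∉X) (sym u∈Y) ≤-refl)

  member⇒size>0 : ∀ {n} (X : Subset n) u → X ! u ≡ true → 0 < size X
  member⇒size>0 {n} X u u∈X = ≤-trans (≤-reflexive (sym (cong b2n u∈X))) (term≤sum n (λ u → b2n (X ! u)) u)

  _ᵀ : ∀ {n} → EdgeRel n → EdgeRel n
  (E ᵀ) u w = E w u

  leaves : ∀ {n} → EdgeRel n → Subset n → EdgeRel n
  leaves E X u w = X ! u ∧ not (X ! w) ∧ E u w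

  cut : ∀ {n} → EdgeRel n → Subset n → ℕ
  cut E X = edgeCount (leaves E X)

  leaves-elim : ∀ {n} (E : EdgeRel n) X u w → leaves E X u w ≡ true →
    X ! u ≡ true × X ! w ≡ false × E u w ≡ true
  leaves-elim E X u w l with X ! u | X ! w | E u w
  ... | true  | false | true  = refl , refl , refl
  leaves-elim E X u w () | true | true | _
  leaves-elim E X u w () | true | false | false
  leaves-elim E X u w () | false | _ | _

  leaves-intro : ∀ {n} (E : EdgeRel n) X u w → X ! u ≡ true → X ! w ≡ false → E u w ≡ true →
    leaves E X u w ≡ true
  leaves-intro E X u w a b c rewrite a | b | c = refl

  cut-mono : ∀ {n} {E E′ : EdgeRel n} (X : Subset n) →
    (∀ u w → X ! u ≡ true → X ! w ≡ false → E u w ≡ true → E′ u w ≡ true) → cut E X ≤ cut E′ X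
  cut-mono {n} {E} {E′} X E⊆E′ = sum²-mono n λ u w → b2n-mono λ l →
    let (u∈ , w∉ , e) = leaves-elim E X u w l in leaves-intro E′ X u w u∈ w∉ (E⊆E′ u w u∈ w∉ e)

  cut-∁ : ∀ {n} (E : EdgeRel n) X → cut E (∁ X) ≡ cut (E ᵀ) X
  cut-∁ {n} E X = trans
    (sum²-cong n λ u w → cong b2n (trans
      (cong₂ (λ a b → a ∧ not b ∧ E u w) (∁-! X u) (∁-! X w)) (swap (X ! u) (X ! w) (E u w))))
    (sum-swap n n λ u w → b2n (leaves (E ᵀ) X w u))
    where
    swap : ∀ a b e → not a ∧ not (not b) ∧ e ≡ b ∧ not a ∧ e
    swap = toWitness {a? = ∀Bool? λ a → ∀Bool? λ b → ∀Bool? λ e → _ ≟ᵇ _} _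

  -- Checked separately for each pair `u`, `w`: the inequality is strict exactly for edges running
  -- between the two differences of `X` and `Y`, which count only on the right.
  cut-submodular : ∀ {n} (E : EdgeRel n) X Y →
    cut E (X ∩ Y) + cut E (X ∪ Y) ≤ cut E X + cut E Y
  cut-submodular {n} E X Y = begin
    cut E (X ∩ Y) + cut E (X ∪ Y)
      ≡⟨ sum²-+ n (λ u w → b2n (leaves E (X ∩ Y) u w)) (λ u w → b2n (leaves E (X ∪ Y) u w)) ⟨
    sum² n (λ u w → b2n (leaves E (X ∩ Y) u w) + b2n (leaves E (X ∪ Y) u w))
      ≤⟨ sum²-mono n (λ u w → pointwise u w) ⟩
    sum² n (λ u w → b2n (leaves E X u w) + b2n (leaves E Y u w))
      ≡⟨ sum²-+ n (λ u w → b2n (leaves E X u w)) (λ u w → b2n (leaves E Y u w)) ⟩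
    cut E X + cut E Y ∎
    where
    open ≤-Reasoning
    bool : ∀ a b c d e → b2n ((a ∧ c) ∧ not (b ∧ d) ∧ e) + b2n ((a ∨ c) ∧ not (b ∨ d) ∧ e)
      ≤ b2n (a ∧ not b ∧ e) + b2n (c ∧ not d ∧ e)
    bool = toWitness {a? = ∀Bool? λ a → ∀Bool? λ b → ∀Bool? λ c → ∀Bool? λ d → ∀Bool? λ e → _ ≤? _} _
    pointwise : ∀ u w → b2n (leaves E (X ∩ Y) u w) + b2n (leaves E (X ∪ Y) u w)
      ≤ b2n (leaves E X u w) + b2n (leaves E Y u w)
    pointwise u w rewrite ∩-! X Y u | ∩-! X Y w | ∪-! X Y u | ∪-! X Y w =
      bool (X ! u) (X ! w) (Y ! u) (Y ! w) (E u w)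

  weight : ∀ {n} → (Fin n → ℕ) → Subset n → ℕ
  weight {n} h X = sumℕ n λ u → b2n (X ! u) * h u

  weight-modular : ∀ {n} (h : Fin n → ℕ) X Y →
    weight h (X ∩ Y) + weight h (X ∪ Y) ≡ weight h X + weight h Y
  weight-modular {n} h X Y = trans (sym (sum-+ n _ _)) (trans (sum-cong n pointwise) (sum-+ n _ _))
    where
    bool : ∀ a c → b2n (a ∧ c) + b2n (a ∨ c) ≡ b2n a + b2n c
    bool = toWitness {a? = ∀Bool? λ a → ∀Bool? λ c → _ ≟ _} _
    pointwise : ∀ u → b2n ((X ∩ Y) ! u) * h u + b2n ((X ∪ Y) ! u) * h u
      ≡ b2n (X ! u) * h u + b2n (Y ! u) * h u
    pointwise u rewrite ∩-! X Y u | ∪-! X Y u =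
      trans (sym (*-distribʳ-+ (h u) (b2n (X ! u ∧ Y ! u)) _))
        (trans (cong (_* h u) (bool (X ! u) (Y ! u))) (*-distribʳ-+ (h u) (b2n (X ! u)) _))

  -- The vertices `u` and `w` certify that `X` is nonempty and proper. In contrast to a statement
  -- about `Reach`, this form is decided directly by enumerating subsets.
  Cuts≥ : ∀ {n} → ℕ → EdgeRel n → Set
  Cuts≥ {n} k E = (X : Subset n) (u w : Fin n) → X ! u ≡ true → X ! w ≡ false → k ≤ cut E X

  cuts≥? : ∀ {n} k (E : EdgeRel n) → Dec (Cuts≥ k E)
  cuts≥? k E with anySubset? (λ X → Fin.any? λ u → Fin.any? λ w →
      (X ! u ≟ᵇ true) ×-dec (X ! w ≟ᵇ false) ×-dec (cut E X <? k))
  ... | yes (X , u , w , u∈ , w∉ , small) = no λ cuts → <⇒≱ small (cuts X u w u∈ w∉)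
  ... | no none = yes λ X u w u∈ w∉ → ≮⇒≥ λ small → none (X , u , w , u∈ , w∉ , small)

  cuts≥-cong : ∀ {n k} {E E′ : EdgeRel n} → (∀ u w → E u w ≡ E′ u w) → Cuts≥ k E → Cuts≥ k E′
  cuts≥-cong {E = E} E≡E′ cuts X u w u∈ w∉ =
    ≤-trans (cuts X u w u∈ w∉) (cut-mono X λ x y _ _ e → trans (sym (E≡E′ x y)) e)

  cuts≥-ᵀ : ∀ {n k} {E : EdgeRel n} → Cuts≥ k E → Cuts≥ k (E ᵀ)
  cuts≥-ᵀ {k = k} {E} cuts X u w u∈ w∉ = subst (k ≤_) (cut-∁ E X)
    (cuts (∁ X) w u (trans (∁-! X w) (cong not w∉)) (trans (∁-! X u) (cong not u∈)))

  -- If fewer than `k` edges left `X`, removing exactly these would trap every walk that starts in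
  -- `X`.
  connected⇒cuts : ∀ {n k} {E : EdgeRel n} → KEdgeConnected k E → Cuts≥ k E
  connected⇒cuts {n} {k} {E} conn X u w u∈ w∉ = ≮⇒≥ λ small →
    true≢false (trans (sym (stays (conn (leaves E X) small u w) u∈)) w∉)
    where
    stays : ∀ {x y} → Reach (removeEdges E (leaves E X)) x y → X ! x ≡ true → X ! y ≡ true
    stays here              x∈ = x∈
    stays (step {x} {z} e r) x∈ = stays r (stays-in (X ! x) (X ! z) (E x z) e x∈)
      where
      stays-in : ∀ a b e → e ∧ not (a ∧ not b ∧ e) ≡ true → a ≡ true → b ≡ true
      stays-in = toWitness {a? = ∀Bool? λ a → ∀Bool? λ b → ∀Bool? λ e →
        (_ ≟ᵇ _) →-dec ((_ ≟ᵇ _) →-dec (_ ≟ᵇ _))} _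

  reach-snoc : ∀ {n} {E : EdgeRel n} {u v w} → Reach E u v → E v w ≡ true → Reach E u w
  reach-snoc here       e = step e here
  reach-snoc (step d r) e = step d (reach-snoc r e)

  reachable-set : ∀ {n} (E : EdgeRel n) u → ∃ λ X → X ! u ≡ true ×
    (∀ x → X ! x ≡ true → Reach E u x) × (∀ x y → X ! x ≡ true → E x y ≡ true → X ! y ≡ true)
  reachable-set {n} E u = grow n (∅ [ u ]≔ true) (lookup∘update u ∅ true) start (m≤m+n n _)
    where
    start : ∀ x → (∅ [ u ]≔ true) ! x ≡ true → Reach E u x
    start x x∈ with x Fin.≟ u
    ... | yes refl = here
    ... | no  x≢u  = true≢false (trans (sym x∈) (trans (lookup∘update′ x≢u ∅ true) (∅-! x)))
    grow : ∀ fuel X → X ! u ≡ true → (∀ x → X ! x ≡ true → Reach E u x) → n ≤ fuel + size X →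
      ∃ λ X → X ! u ≡ true × (∀ x → X ! x ≡ true → Reach E u x) ×
        (∀ x y → X ! x ≡ true → E x y ≡ true → X ! y ≡ true)
    grow fuel X u∈ reach bound with Fin.any? (λ x → Fin.any? λ y →
        (X ! x ≟ᵇ true) ×-dec (X ! y ≟ᵇ false) ×-dec (E x y ≟ᵇ true))
    ... | no none = X , u∈ , reach , λ x y x∈ e → decidable-stable (X ! y ≟ᵇ true) λ y∉ →
      none (x , y , x∈ , ¬-not y∉ , e)
    ... | yes (x , y , x∈ , y∉ , e) = continue fuel bound
      where
      X′ = X [ y ]≔ true
      X⊆X′ : ∀ z → X ! z ≡ true → X′ ! z ≡ true
      X⊆X′ z z∈ with z Fin.≟ y
      ... | yes refl = lookup∘update y X true
      ... | no  z≢y  = trans (lookup∘update′ z≢y X true) z∈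
      reach′ : ∀ z → X′ ! z ≡ true → Reach E u z
      reach′ z z∈ with z Fin.≟ y
      ... | yes refl = reach-snoc (reach x x∈) e
      ... | no  z≢y  = reach z (trans (sym (lookup∘update′ z≢y X true)) z∈)
      bigger : size X < size X′
      bigger = size-mono-< {X = X} {X′} X⊆X′ y y∉ (lookup∘update y X true)
      continue : ∀ fuel → n ≤ fuel + size X → _
      -- Without fuel the bound says that `X` already has `n` vertices, so it cannot grow.
      continue zero       b = ⊥-elim (<⇒≱ (<-≤-trans bigger (size≤n X′)) b)
      continue (suc fuel) b = grow fuel X′ (X⊆X′ u u∈) reach′
        (≤-trans b (≤-trans (≤-reflexive (sym (+-suc fuel _))) (+-monoʳ-≤ fuel bigger)))

  -- If `w` is unreachable after removing `F`, every edge of `E` leaving the reachable set must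
  -- belong to `F`, so `F` has at least `k` edges.
  cuts⇒connected : ∀ {n k} {E : EdgeRel n} → Cuts≥ k E → KEdgeConnected k E
  cuts⇒connected {n} {k} {E} cuts F few u w with reachable-set (removeEdges E F) u
  ... | X , u∈ , reach , closed with X ! w in w∈
  ...   | true  = reach w w∈
  ...   | false = ⊥-elim (<⇒≱ few (≤-trans (cuts X u w u∈ w∈)
    (sum²-mono n λ x y → b2n-mono λ l → removed x y (leaves-elim E X x y l))))
    where
    removed : ∀ x y → X ! x ≡ true × X ! y ≡ false × E x y ≡ true → F x y ≡ true
    removed x y (x∈ , y∉ , e) with F x y in f
    ... | true  = refl
    ... | false = true≢false (trans (sym (closed x y x∈ (cong₂ (λ a b → a ∧ not b) e f))) y∉)

-- Cheap augmentation: minimal extensions, uncrossing tight sets, charging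

module Augmentation where

  open Sums
  open Cuts
  open import Data.Nat
  open import Data.Nat.Properties
  open import Data.Nat.Tactic.RingSolver using (solve-∀)
  open import Data.Bool using (Bool; true; false; _∧_; _∨_; not)
  open import Data.Bool.Properties using (¬-not) renaming (_≟_ to _≟ᵇ_)
  open import Data.Empty using (⊥-elim)
  open import Data.Fin using (Fin; zero; suc)
  import Data.Fin.Properties as Fin
  open import Data.Fin.Subset using (Subset; _∩_; _∪_; ∁) renaming (⊥ to ∅)
  open import Data.Fin.Subset.Properties using (anySubset?; ∪-assoc; ∪-comm)
  open import Data.List using (List; []; _∷_; allFin)
  open import Data.List.Membership.Propositional using (_∈_)
  open import Data.List.Membership.Propositional.Properties using (∈-allFin)
  open import Data.List.Relation.Unary.Any using () renaming (here to hereᴸ; there to thereᴸ)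
  open import Data.Product using (∃; _×_; _,_; proj₁; proj₂)
  open import Data.Vec using ([]; _∷_)
  open import Function using (_∘_)
  open import Relation.Binary.PropositionalEquality
  open import Relation.Nullary using (Dec; yes; no; ¬_; does)
  open import Relation.Nullary.Decidable using (_×-dec_; _→-dec_; ¬?; toWitness; dec-true; dec-false)

  Disjoint : ∀ {n} → Subset n → Subset n → Set
  Disjoint X Y = ∀ u → X ! u ≡ true → Y ! u ≡ false

  disjoint? : ∀ {n} (X Y : Subset n) → Dec (Disjoint X Y)
  disjoint? X Y = Fin.all? λ u → (X ! u ≟ᵇ true) →-dec (Y ! u ≟ᵇ false)

  common : ∀ {n} (X Y : Subset n) → ¬ Disjoint X Y → ∃ λ u → X ! u ≡ true × Y ! u ≡ true
  common X Y ¬disj with Fin.any? (λ u → (X ! u ≟ᵇ true) ×-dec (Y ! u ≟ᵇ true))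
  ... | yes c   = c
  ... | no none = ⊥-elim (¬disj λ u u∈X → ¬-not λ u∈Y → none (u , u∈X , u∈Y))

  weight-disjoint : ∀ {n} (h : Fin n → ℕ) X Y → Disjoint X Y →
    weight h (X ∪ Y) ≡ weight h X + weight h Y
  weight-disjoint {n} h X Y disj = trans (sum-cong n pointwise) (sum-+ n _ _)
    where
    pointwise : ∀ u → b2n ((X ∪ Y) ! u) * h u ≡ b2n (X ! u) * h u + b2n (Y ! u) * h u
    pointwise u rewrite ∪-! X Y u with X ! u in u∈
    ... | false = refl
    ... | true rewrite disj u u∈ = sym (+-identityʳ _)

  weight-∅ : ∀ {n} (h : Fin n → ℕ) → weight h ∅ ≡ 0
  weight-∅ {n} h = trans (sum-cong n λ u → cong (λ b → b2n b * h u) (∅-! u)) (sum-zero n)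

  added : ∀ {n} → EdgeRel n → EdgeRel n → EdgeRel n
  added E E′ u w = E′ u w ∧ not (E u w)

  module _ {n : ℕ} (k : ℕ) (Z : Subset n) (E : EdgeRel n) where

    Demand : EdgeRel n → Set
    Demand E′ = ∀ X u → X ! u ≡ true → Disjoint X Z → k ≤ cut E′ X

    -- Under `Demand` the inequality `cut E′ X ≤ k` is an equality: such a set cannot afford to lose
    -- a leaving edge.
    Tight : EdgeRel n → Subset n → Set
    Tight E′ X = ∃ (λ u → X ! u ≡ true) × Disjoint X Z × cut E′ X ≤ k

    record Extension (E′ : EdgeRel n) : Set where
      field
        extends : ∀ u w → E u w ≡ true → E′ u w ≡ true
        to-hub  : ∀ u w → added E E′ u w ≡ true → Z ! u ≡ false × Z ! w ≡ true
        demand  : Demand E′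

    open Extension

    -- Minimality of the extension in local form. An added edge ends in the hub, so it leaves the
    -- tight set containing its tail and cannot be deleted.
    Critical : EdgeRel n → Set
    Critical E′ = ∀ u w → added E E′ u w ≡ true → ∃ λ X → X ! u ≡ true × Disjoint X Z × cut E′ X ≤ k

    all-hub-edges : EdgeRel n
    all-hub-edges u w = E u w ∨ (not (Z ! u) ∧ Z ! w)

    -- The starting point for pruning: a single vertex of a set avoiding the hub already sends an
    -- edge to each of the at least `k` hub vertices.
    all-hub-edges-extension : k ≤ size Z → Extension all-hub-edges
    all-hub-edges-extension k≤Z = record { extends = ext ; to-hub = hub ; demand = dem }
      where
      ext : ∀ u w → E u w ≡ true → all-hub-edges u w ≡ true
      ext u w e rewrite e = refl
      bool : ∀ e a b → (e ∨ (not a ∧ b)) ∧ not e ≡ true → a ≡ false × b ≡ true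
      bool = toWitness {a? = ∀Bool? λ e → ∀Bool? λ a → ∀Bool? λ b →
        (_ ≟ᵇ _) →-dec ((_ ≟ᵇ _) ×-dec (_ ≟ᵇ _))} _
      hub : ∀ u w → added E all-hub-edges u w ≡ true → Z ! u ≡ false × Z ! w ≡ true
      hub u w = bool (E u w) (Z ! u) (Z ! w)
      dem : Demand all-hub-edges
      dem X u u∈ disj = ≤-trans k≤Z (≤-trans
        (sum-mono n λ w → b2n-mono λ w∈ → leaves-intro all-hub-edges X u w u∈ (w∉X w w∈) (edge w w∈))
        (term≤sum n (λ u → sumℕ n λ w → b2n (leaves all-hub-edges X u w)) u))
        where
        w∉X : ∀ w → Z ! w ≡ true → X ! w ≡ false
        w∉X w w∈Z = ¬-not λ w∈X → true≢false (trans (sym w∈Z) (disj w w∈X))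
        edge : ∀ w → Z ! w ≡ true → all-hub-edges u w ≡ true
        edge w w∈ rewrite disj u u∈ | w∈ with E u w
        ... | true  = refl
        ... | false = refl

    module _ (E′ : EdgeRel n) (u₀ w₀ : Fin n) where
      delete : EdgeRel n
      delete u w = E′ u w ∧ not (does (u Fin.≟ u₀) ∧ does (w Fin.≟ w₀))

      delete-at : delete u₀ w₀ ≡ false
      delete-at rewrite dec-true (u₀ Fin.≟ u₀) refl | dec-true (w₀ Fin.≟ w₀) refl with E′ u₀ w₀
      ... | true  = refl
      ... | false = refl

      delete-elsewhere : ∀ u w → ¬ (u ≡ u₀ × w ≡ w₀) → delete u w ≡ E′ u w
      delete-elsewhere u w ≢ with u Fin.≟ u₀ | w Fin.≟ w₀ | E′ u w
      ... | yes a | yes b | _     = ⊥-elim (≢ (a , b))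
      ... | yes _ | no _  | true  = refl
      ... | yes _ | no _  | false = refl
      ... | no _  | _     | true  = refl
      ... | no _  | _     | false = refl

      delete-⊆ : ∀ u w → delete u w ≡ true → E′ u w ≡ true
      delete-⊆ u w d = ∧-trueˡ d

      cut-delete : ∀ X → cut E′ X ≤ 1 + cut delete X
      cut-delete X = sum²-mono-but-one n 1 u₀ w₀
        (λ u w ≢ → ≤-reflexive (cong (λ e → b2n (X ! u ∧ not (X ! w) ∧ e)) (sym (delete-elsewhere u w ≢))))
        (≤-trans (b2n≤1 _) (m≤m+n 1 _))

      cut-delete-∉ : ∀ X → X ! u₀ ≡ false → cut E′ X ≤ cut delete X
      cut-delete-∉ X u₀∉ = cut-mono X λ u w u∈ _ e →
        trans (delete-elsewhere u w λ { (refl , _) → true≢false (trans (sym u∈) u₀∉) }) e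

      -- Deleting one edge lowers a cut by at most one, and only for sets containing `u₀`. By
      -- `slack` these had more than `k` leaving edges.
      delete-extension : Extension E′ → added E E′ u₀ w₀ ≡ true →
        ¬ (∃ λ X → X ! u₀ ≡ true × Disjoint X Z × cut E′ X ≤ k) → Extension delete
      delete-extension ext add slack = record
        { extends = λ u w e → trans
            (delete-elsewhere u w λ { (refl , refl) →
              true≢false (trans (sym e) (not-true (∧-trueʳ {E′ u w} add))) })
            (extends ext u w e)
        ; to-hub = λ u w a → to-hub ext u w (weaken (E u w) (delete-⊆ u w) a)
        ; demand = λ X u u∈ disj → dem X u u∈ disj (X ! u₀) refl
        }
        where
        weaken : ∀ {a b} c → (a ≡ true → b ≡ true) → a ∧ not c ≡ true → b ∧ not c ≡ true
        weaken {true} c a⇒b eq rewrite a⇒b refl = eq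
        dem : ∀ X u → X ! u ≡ true → Disjoint X Z → ∀ b → X ! u₀ ≡ b → k ≤ cut delete X
        dem X u u∈ disj false u₀∉ = ≤-trans (demand ext X u u∈ disj) (cut-delete-∉ X u₀∉)
        dem X u u∈ disj true  u₀∈ = s≤s⁻¹ (≤-trans
          (≰⇒> λ tight → slack (X , u₀∈ , disj , tight)) (cut-delete X))

      delete-fewer : E′ u₀ w₀ ≡ true → added E E′ u₀ w₀ ≡ true →
        edgeCount (added E delete) < edgeCount (added E E′)
      delete-fewer e add = sum-mono-< n (λ u → sum-mono n (pointwise u)) u₀
        (sum-mono-< n (pointwise u₀) w₀ (subst₂ (λ a b → b2n (a ∧ not (E u₀ w₀)) < b2n b) (sym delete-at) (sym add) ≤-refl))
        where
        pointwise : ∀ u w → b2n (added E delete u w) ≤ b2n (added E E′ u w)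
        pointwise u w = b2n-mono λ a → cong₂ _∧_ (delete-⊆ u w (∧-trueˡ a)) (∧-trueʳ {delete u w} a)

    prune : ∀ fuel E′ → Extension E′ → edgeCount (added E E′) ≤ fuel →
      ∃ λ E″ → Extension E″ × Critical E″
    prune fuel E′ ext bound with Fin.any? (λ u → Fin.any? λ w → (added E E′ u w ≟ᵇ true) ×-dec
        ¬? (anySubset? λ X → (X ! u ≟ᵇ true) ×-dec disjoint? X Z ×-dec (cut E′ X ≤? k)))
    ... | no none = E′ , ext , critical
      where
      critical : Critical E′
      critical u w a with anySubset? (λ X → (X ! u ≟ᵇ true) ×-dec disjoint? X Z ×-dec (cut E′ X ≤? k))
      ... | yes tight = tight
      ... | no slack  = ⊥-elim (none (u , w , a , slack))
    ... | yes (u , w , a , slack) = continue fuel bound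
      where
      fewer = delete-fewer E′ u w (∧-trueˡ a) a
      continue : ∀ fuel → edgeCount (added E E′) ≤ fuel → ∃ λ E″ → Extension E″ × Critical E″
      continue zero       b = ⊥-elim (<⇒≱ fewer (≤-trans b z≤n))
      continue (suc fuel) b = prune fuel (delete E′ u w) (delete-extension E′ u w ext a slack)
        (s≤s⁻¹ (≤-trans fewer b))

    module _ {E′ : EdgeRel n} (ext : Extension E′) (crit : Critical E′) where

      -- The uncrossing step. The intersection is nonempty and avoids the hub, so its cut takes at
      -- least `k` of the total 2k that submodularity allows, leaving at most `k` for the union.
      tight-∪ : ∀ {X Y} → Tight E′ X → Tight E′ Y → ¬ Disjoint X Y → Tight E′ (X ∪ Y)
      tight-∪ {X} {Y} ((x , x∈) , X∥Z , tX) (_ , Y∥Z , tY) meet =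
        (x , ∪-introˡ X Y x x∈) , X∪Y∥Z , +-cancelˡ-≤ k _ _ (begin
          k + cut E′ (X ∪ Y)                ≤⟨ +-monoˡ-≤ _ ∩-demand ⟩
          cut E′ (X ∩ Y) + cut E′ (X ∪ Y)   ≤⟨ cut-submodular E′ X Y ⟩
          cut E′ X + cut E′ Y               ≤⟨ +-mono-≤ tX tY ⟩
          k + k                             ∎)
        where
        open ≤-Reasoning
        X∪Y∥Z : Disjoint (X ∪ Y) Z
        X∪Y∥Z u u∈ with X ! u in u∈X
        ... | true  = X∥Z u u∈X
        ... | false = Y∥Z u (trans (sym (trans (∪-! X Y u) (cong (_∨ (Y ! u)) u∈X))) u∈)
        ∩-demand : k ≤ cut E′ (X ∩ Y)
        ∩-demand = let (c , c∈X , c∈Y) = common X Y meet in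
          demand ext (X ∩ Y) c (∩-intro X Y c c∈X c∈Y) λ u u∈ → X∥Z u (∩-elimˡ X Y u u∈)

      -- A family of pairwise disjoint tight sets, indexed by its union. The counting needs only
      -- that weights add up along it.
      data TightUnion : Subset n → Set where
        none : TightUnion ∅
        more : ∀ {X U} → Tight E′ X → TightUnion U → Disjoint X U → TightUnion (X ∪ U)

      -- The new set absorbs every member that it meets, remaining tight by `tight-∪`, and passes by
      -- the members disjoint from it. The union of the family grows by exactly `X`.
      insert : ∀ {U X} → TightUnion U → Tight E′ X → TightUnion (X ∪ U)
      insert none tX = more tX none λ u _ → ∅-! u
      insert {X = X} (more {Y} {U} tY tU Y∥U) tX with disjoint? X Y
      ... | yes X∥Y = subst TightUnion swap (more tY (insert tU tX) Y∥X∪U)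
        where
        swap : Y ∪ (X ∪ U) ≡ X ∪ (Y ∪ U)
        swap = trans (sym (∪-assoc Y X U)) (trans (cong (_∪ U) (∪-comm Y X)) (∪-assoc X Y U))
        Y∥X∪U : Disjoint Y (X ∪ U)
        Y∥X∪U u u∈ = ∪-false X U u
          (¬-not λ u∈X → true≢false (trans (sym u∈) (X∥Y u u∈X))) (Y∥U u u∈)
      ... | no meet = subst TightUnion (∪-assoc X Y U) (insert tU (tight-∪ {X} {Y} tX tY meet))

      out-added : Fin n → ℕ
      out-added u = sumℕ n λ w → b2n (added E E′ u w)

      cover : (us : List (Fin n)) →
        ∃ λ U → TightUnion U × (∀ u → u ∈ us → 0 < out-added u → U ! u ≡ true)
      cover [] = ∅ , none , λ _ ()
      cover (x ∷ us) with cover us | out-added x in eq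
      ... | U , tU , covers | zero = U , tU , λ
        { u (hereᴸ refl) pos → ⊥-elim (<⇒≢ pos (sym eq)) ; u (thereᴸ u∈) pos → covers u u∈ pos }
      ... | U , tU , covers | suc _ with sum-positive n _ (subst (0 <_) (sym eq) z<s)
      ...   | w , a with crit x w (b2n-true a)
      ...     | X , x∈ , X∥Z , tX = X ∪ U , insert tU ((x , x∈) , X∥Z , tX) , λ
        { u (hereᴸ refl) _   → ∪-introˡ X U u x∈
        ; u (thereᴸ u∈)  pos → ∪-introʳ X U u (covers u u∈ pos) }

      -- Added edges end in the hub, hence outside `X`, so all those starting in `X` leave it,
      -- besides the original leaving edges. Hence a tight set has at most `k` added edges, and if
      -- it has any, its cut in `E` is below `k`.
      weight-added : ∀ X → Disjoint X Z → weight out-added X + cut E X ≤ cut E′ X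
      weight-added X X∥Z = begin
        weight out-added X + cut E X
          ≡⟨ cong (_+ cut E X) (sum-cong n λ u → sym (sum-*ˡ n (b2n (X ! u)) _)) ⟩
        sum² n (λ u w → b2n (X ! u) * b2n (added E E′ u w)) + cut E X
          ≡⟨ sum²-+ n _ (λ u w → b2n (leaves E X u w)) ⟨
        sum² n (λ u w → b2n (X ! u) * b2n (added E E′ u w) + b2n (leaves E X u w))
          ≤⟨ sum²-mono n (λ u w → bool (X ! u) (X ! w) (E u w) (E′ u w) (extends ext u w)
               λ a → ¬-not λ w∈ → true≢false (trans (sym (proj₂ (to-hub ext u w a))) (X∥Z w w∈))) ⟩
        cut E′ X ∎
        where
        open ≤-Reasoning
        bool : ∀ x y e e′ → (e ≡ true → e′ ≡ true) → (e′ ∧ not e ≡ true → y ≡ false) →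
          b2n x * b2n (e′ ∧ not e) + b2n (x ∧ not y ∧ e) ≤ b2n (x ∧ not y ∧ e′)
        bool = toWitness {a? = ∀Bool? λ x → ∀Bool? λ y → ∀Bool? λ e → ∀Bool? λ e′ →
          ((_ ≟ᵇ _) →-dec (_ ≟ᵇ _)) →-dec (((_ ≟ᵇ _) →-dec (_ ≟ᵇ _)) →-dec (_ ≤? _))} _

      module _ (s : ℕ) (P : Fin n → Bool)
        (hits : ∀ X u → X ! u ≡ true → cut E X < k → size X ≤ s → ∃ λ x → X ! x ≡ true × P x ≡ true)
        where

        -- A tight set with an added edge violates the demand in E, so it is either
        -- large or contains a vertex of P; charge pays for its at most k added edges.
        charge : Fin n → ℕ
        charge u = k * (s * b2n (P u) + 1)

        tight-charge : ∀ {X} → Tight E′ X → s * weight out-added X ≤ weight charge X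
        tight-charge {X} ((x , x∈) , X∥Z , tX) with weight out-added X in eq
        ... | zero  = ≤-trans (≤-reflexive (*-zeroʳ s)) z≤n
        ... | suc a = ≤-trans (*-monoʳ-≤ s a<k) (charged (size X ≤? s))
          where
          total : suc a + cut E X ≤ k
          total = subst (λ b → b + cut E X ≤ k) eq (≤-trans (weight-added X X∥Z) tX)
          a<k : suc a ≤ k
          a<k = ≤-trans (m≤m+n (suc a) _) total
          small-cut : cut E X < k
          small-cut = ≤-trans (s≤s (m≤n+m _ a)) total
          charged : Dec (size X ≤ s) → s * k ≤ weight charge X
          -- A small set is paid for by its vertex of `P`, whose charge is `s * k + k`; a large one
          -- by the share `k` that each of its more than `s` vertices contributes.
          charged (yes small) = let (p , p∈ , Pp) = hits X x x∈ small-cut small in begin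
            s * k                      ≤⟨ m≤m+n _ k ⟩
            s * k + k                  ≡⟨ identity k s ⟩
            1 * (k * (s * 1 + 1))      ≡⟨ cong₂ (λ a b → b2n a * (k * (s * b2n b + 1))) p∈ Pp ⟨
            b2n (X ! p) * charge p     ≤⟨ term≤sum n (λ u → b2n (X ! u) * charge u) p ⟩
            weight charge X            ∎
            where
            open ≤-Reasoning
            identity : ∀ k s → s * k + k ≡ 1 * (k * (s * 1 + 1))
            identity = solve-∀
          charged (no large) = begin
            s * k              ≤⟨ *-monoˡ-≤ k (<⇒≤ (≰⇒> large)) ⟩
            size X * k         ≡⟨ sum-*ʳ n k _ ⟨
            weight (λ _ → k) X ≤⟨ sum-mono n (λ u → *-monoʳ-≤ (b2n (X ! u)) (one u)) ⟩
            weight charge X    ∎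
            where
            open ≤-Reasoning
            one : ∀ u → k ≤ charge u
            one u = ≤-trans (≤-reflexive (sym (*-identityʳ k))) (*-monoʳ-≤ k (m≤n+m 1 _))

        union-charge : ∀ {U} → TightUnion U → s * weight out-added U ≤ weight charge U
        union-charge none rewrite weight-∅ out-added | *-zeroʳ s = z≤n
        union-charge (more {X} {U} tX tU X∥U) = begin
          s * weight out-added (X ∪ U)                     ≡⟨ cong (s *_) (weight-disjoint out-added X U X∥U) ⟩
          s * (weight out-added X + weight out-added U)    ≡⟨ *-distribˡ-+ s _ _ ⟩
          s * weight out-added X + s * weight out-added U  ≤⟨ +-mono-≤ (tight-charge {X} tX) (union-charge tU) ⟩
          weight charge X + weight charge U                ≡⟨ weight-disjoint charge X U X∥U ⟨
          weight charge (X ∪ U)                            ∎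
          where open ≤-Reasoning

        few-added : s * edgeCount (added E E′) ≤ k * (s * sumℕ n (b2n ∘ P) + n)
        few-added with cover (allFin n)
        ... | U , tU , covers = begin
          s * sumℕ n out-added            ≤⟨ *-monoʳ-≤ s (sum-mono n covered) ⟩
          s * weight out-added U          ≤⟨ union-charge tU ⟩
          weight charge U                 ≤⟨ sum-mono n (λ u → ≤-trans (*-monoˡ-≤ (charge u) (b2n≤1 (U ! u)))
                                               (≤-reflexive (*-identityˡ _))) ⟩
          sumℕ n charge                   ≡⟨ sum-*ˡ n k _ ⟩
          k * sumℕ n (λ u → s * b2n (P u) + 1)
            ≡⟨ cong (k *_) (trans (sum-+ n _ _) (cong₂ _+_ (sum-*ˡ n s _)
                 (trans (sum-const n 1) (*-identityʳ n)))) ⟩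
          k * (s * sumℕ n (b2n ∘ P) + n)  ∎
          where
          open ≤-Reasoning
          covered : ∀ u → out-added u ≤ b2n (U ! u) * out-added u
          covered u with out-added u in eq
          ... | zero  = z≤n
          ... | suc m rewrite covers u (∈-allFin u) (subst (0 <_) (sym eq) z<s) =
            ≤-reflexive (sym (*-identityˡ _))

    minimal-extension : k ≤ size Z → ∃ λ E′ → Extension E′ × Critical E′
    minimal-extension k≤Z = prune _ all-hub-edges (all-hub-edges-extension k≤Z) ≤-refl

  subset-of-size : ∀ n m → m ≤ n → ∃ λ (Z : Subset n) → size Z ≡ m
  subset-of-size n       zero    _       = ∅ , trans (sum-cong n λ u → cong b2n (∅-! u)) (sum-zero n)
  subset-of-size (suc n) (suc m) (s≤s l) =
    let (Z , eq) = subset-of-size n m l in true ∷ Z , cong suc eq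

  Hits : ∀ {n} → ℕ → ℕ → EdgeRel n → (Fin n → Bool) → Set
  Hits k s E P = ∀ X u → X ! u ≡ true → cut E X < k → size X ≤ s → ∃ λ x → X ! x ≡ true × P x ≡ true

  -- This is (a - 1)(b - 1) ≥ 0. It explains the hub size k + 1: a cut splitting the complete hub
  -- into parts of sizes `a` and `b` is crossed by `a * b` hub edges.
  product-bound : ∀ a b k → a + b ≡ suc k → 0 < a → 0 < b → k ≤ a * b
  product-bound (suc a) (suc b) k eq _ _ = s≤s⁻¹ (begin
    suc k                          ≡⟨ eq ⟨
    suc a + suc b                  ≤⟨ m≤m+n _ (a * b) ⟩
    suc a + suc b + a * b          ≡⟨ identity a b ⟩
    suc (suc a * suc b)            ∎)
    where
    open ≤-Reasoning
    identity : ∀ a b → suc a + suc b + a * b ≡ suc (suc a * suc b)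
    identity = solve-∀

  -- The edges needed for out-cuts and for in-cuts avoiding the hub Z are found
  -- separately; cuts separating two hub vertices are covered by making Z complete.
  cheap-augmentation : ∀ {n} k s (E : EdgeRel n) (P Q : Fin n → Bool) → k < n → Loopless E →
    Hits k s E P → Hits k s (E ᵀ) Q →
    ∃ λ F → Loopless F × KEdgeConnected k F ×
      s * editDist E F ≤ k * (s * sumℕ n (b2n ∘ P) + n) + k * (s * sumℕ n (b2n ∘ Q) + n) + s * (suc k * suc k)
  cheap-augmentation {n} k s E P Q k<n noloop hitP hitQ = F , noloopF , cuts⇒connected cuts , bound
    where
    hub = subset-of-size n (suc k) k<n
    Z = proj₁ hub
    |Z| : size Z ≡ suc k
    |Z| = proj₂ hub
    k≤Z : k ≤ size Z
    k≤Z = subst (k ≤_) (sym |Z|) (n≤1+n k)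
    out = minimal-extension k Z E k≤Z
    inn = minimal-extension k Z (E ᵀ) k≤Z
    E₁ = proj₁ out
    E₂ = proj₁ inn
    ext₁ = proj₁ (proj₂ out)
    ext₂ = proj₁ (proj₂ inn)

    F : EdgeRel n
    F u w = E₁ u w ∨ E₂ w u ∨ (Z ! u ∧ Z ! w ∧ not (does (u Fin.≟ w)))

    -- An added edge runs from outside the hub into it, so it is never a loop.
    no-self : ∀ {E E′ : EdgeRel n} → Loopless E → Extension k Z E E′ → ∀ v → E′ v v ≡ false
    no-self {E} {E′} noloop ext v = ¬-not λ e →
      let (v∉ , v∈) = Extension.to-hub ext v v (cong₂ (λ a b → a ∧ not b) e (noloop v))
      in true≢false (trans (sym v∈) v∉)

    noloopF : Loopless F
    noloopF v rewrite no-self noloop ext₁ v | no-self noloop ext₂ v | dec-true (v Fin.≟ v) refl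
      with Z ! v
    ... | true  = refl
    ... | false = refl

    F₁ : ∀ u w → E₁ u w ≡ true → F u w ≡ true
    F₁ u w e rewrite e = refl
    F₂ : ∀ u w → E₂ w u ≡ true → F u w ≡ true
    F₂ u w e rewrite e with E₁ u w
    ... | true  = refl
    ... | false = refl
    F₃ : ∀ u w → Z ! u ≡ true → Z ! w ≡ true → ¬ u ≡ w → F u w ≡ true
    F₃ u w u∈ w∈ u≢w rewrite u∈ | w∈ | dec-false (u Fin.≟ w) u≢w with E₁ u w | E₂ w u
    ... | true  | _     = refl
    ... | false | true  = refl
    ... | false | false = refl

    cuts : Cuts≥ k F
    cuts X u w u∈ w∉ with disjoint? X Z | disjoint? (∁ X) Z
    ... | yes X∥Z | _ = ≤-trans (Extension.demand ext₁ X u u∈ X∥Z) (cut-mono X λ x y _ _ → F₁ x y)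
    ... | no _ | yes ∁X∥Z = ≤-trans
      (Extension.demand ext₂ (∁ X) w (trans (∁-! X w) (cong not w∉)) ∁X∥Z)
      (≤-trans (≤-reflexive (cut-∁ E₂ X)) (cut-mono X λ x y _ _ → F₂ x y))
    ... | no X∦Z | no ∁X∦Z with common X Z X∦Z | common (∁ X) Z ∁X∦Z
    ...   | z , z∈X , z∈Z | y , y∈∁X , y∈Z = begin
      k                                            ≤⟨ product-bound (size (X ∩ Z)) (size (∁ X ∩ Z)) k total
                                                        (member⇒size>0 (X ∩ Z) z (∩-intro X Z z z∈X z∈Z))
                                                        (member⇒size>0 (∁ X ∩ Z) y (∩-intro (∁ X) Z y y∈∁X y∈Z)) ⟩
      size (X ∩ Z) * size (∁ X ∩ Z)                ≡⟨ sum²-product n _ _ ⟨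
      sum² n (λ u w → b2n ((X ∩ Z) ! u) * b2n ((∁ X ∩ Z) ! w))
        ≤⟨ sum²-mono n (λ u w → product≤ ((X ∩ Z) ! u) ((∁ X ∩ Z) ! w) (crosses u w)) ⟩
      cut F X                                      ∎
      where
      open ≤-Reasoning
      total : size (X ∩ Z) + size (∁ X ∩ Z) ≡ suc k
      total = trans (sym (sum-+ n _ _)) (trans (sum-cong n split) |Z|)
        where
        split : ∀ u → b2n ((X ∩ Z) ! u) + b2n ((∁ X ∩ Z) ! u) ≡ b2n (Z ! u)
        split u rewrite ∩-! X Z u | ∩-! (∁ X) Z u | ∁-! X u with X ! u | Z ! u
        ... | true  | true  = refl
        ... | true  | false = refl
        ... | false | true  = refl
        ... | false | false = refl
      product≤ : ∀ a b {c} → (a ≡ true → b ≡ true → c ≡ true) → b2n a * b2n b ≤ b2n c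
      product≤ false b     _ = z≤n
      product≤ true  false _ = z≤n
      product≤ true  true  c rewrite c refl refl = ≤-refl
      crosses : ∀ u w → (X ∩ Z) ! u ≡ true → (∁ X ∩ Z) ! w ≡ true → leaves F X u w ≡ true
      crosses u w u∈ w∈ = leaves-intro F X u w u∈X w∉X
        (F₃ u w (∩-elimʳ X Z u u∈) (∩-elimʳ (∁ X) Z w w∈) λ { refl → true≢false (trans (sym u∈X) w∉X) })
        where
        u∈X = ∩-elimˡ X Z u u∈
        w∉X = not-true (trans (sym (∁-! X w)) (∩-elimˡ (∁ X) Z w w∈))

    edits : editDist E F ≤ edgeCount (added E E₁) + edgeCount (added (E ᵀ) E₂) + suc k * suc k
    edits = begin
      editDist E F ≤⟨ sum²-mono n (λ u w → bool (E u w) (E₁ u w) (E₂ w u) (Z ! u) (Z ! w)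
                        (does (u Fin.≟ w)) (Extension.extends ext₁ u w) (Extension.extends ext₂ w u)) ⟩
      sum² n (λ u w → b2n (added E E₁ u w) + b2n (added (E ᵀ) E₂ w u) + b2n (Z ! u) * b2n (Z ! w))
        ≡⟨ trans (sum²-+ n (λ u w → b2n (added E E₁ u w) + b2n (added (E ᵀ) E₂ w u)) _)
             (cong (_+ sum² n (λ u w → b2n (Z ! u) * b2n (Z ! w))) (sum²-+ n (λ u w → b2n (added E E₁ u w)) _)) ⟩
      edgeCount (added E E₁) + sum² n (λ u w → b2n (added (E ᵀ) E₂ w u)) + sum² n (λ u w → b2n (Z ! u) * b2n (Z ! w))
        ≡⟨ cong₂ (λ a b → edgeCount (added E E₁) + a + b)
             (sum-swap n n λ u w → b2n (added (E ᵀ) E₂ w u))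
             (trans (sum²-product n _ _) (cong₂ _*_ |Z| |Z|)) ⟩
      edgeCount (added E E₁) + edgeCount (added (E ᵀ) E₂) + suc k * suc k ∎
      where
      open ≤-Reasoning
      bool : ∀ e e₁ e₂ a b d → (e ≡ true → e₁ ≡ true) → (e ≡ true → e₂ ≡ true) →
        b2n (xorB e (e₁ ∨ e₂ ∨ (a ∧ b ∧ not d))) ≤ b2n (e₁ ∧ not e) + b2n (e₂ ∧ not e) + b2n a * b2n b
      bool = toWitness {a? = ∀Bool? λ e → ∀Bool? λ e₁ → ∀Bool? λ e₂ → ∀Bool? λ a → ∀Bool? λ b → ∀Bool? λ d →
        ((_ ≟ᵇ _) →-dec (_ ≟ᵇ _)) →-dec (((_ ≟ᵇ _) →-dec (_ ≟ᵇ _)) →-dec (_ ≤? _))} _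

    bound : s * editDist E F ≤ k * (s * sumℕ n (b2n ∘ P) + n) + k * (s * sumℕ n (b2n ∘ Q) + n) + s * (suc k * suc k)
    bound = begin
      s * editDist E F ≤⟨ *-monoʳ-≤ s edits ⟩
      s * (edgeCount (added E E₁) + edgeCount (added (E ᵀ) E₂) + suc k * suc k)
        ≡⟨ distrib s _ _ (suc k * suc k) ⟩
      s * edgeCount (added E E₁) + s * edgeCount (added (E ᵀ) E₂) + s * (suc k * suc k)
        ≤⟨ +-monoˡ-≤ _ (+-mono-≤ (few-added k Z E ext₁ (proj₂ (proj₂ out)) s P hitP)
             (few-added k Z (E ᵀ) ext₂ (proj₂ (proj₂ inn)) s Q hitQ)) ⟩
      k * (s * sumℕ n (b2n ∘ P) + n) + k * (s * sumℕ n (b2n ∘ Q) + n) + s * (suc k * suc k) ∎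
      where
      open ≤-Reasoning
      distrib : ∀ s a b c → s * (a + b + c) ≡ s * a + s * b + s * c
      distrib = solve-∀

-- Natural numbers and fractions inside the rationals

module Rationals where

  open import Data.Nat as ℕ using (ℕ; suc)
  import Data.Nat.Properties as ℕ
  open import Data.Integer as ℤ using (+_; -[1+_])
  import Data.Integer.Properties as ℤ
  open import Data.Rational
  open import Data.Rational.Properties
  open import Data.Rational.Solver using (module +-*-Solver)
  import Data.Rational.Unnormalised as ℚᵘ
  import Data.Rational.Unnormalised.Properties as ℚᵘ
  open import Relation.Binary.PropositionalEquality hiding ([_])

  private
    embed : ∀ k → toℚᵘ (ℕtoℚ k) ℚᵘ.≃ ℚᵘ.mkℚᵘ (+ k) 0
    embed k = toℚᵘ-fromℚᵘ (ℚᵘ.mkℚᵘ (+ k) 0)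

  ℕtoℚ-+ : ∀ a b → ℕtoℚ (a ℕ.+ b) ≡ ℕtoℚ a + ℕtoℚ b
  ℕtoℚ-+ a b = toℚᵘ-injective (begin
    toℚᵘ (ℕtoℚ (a ℕ.+ b))                      ≈⟨ embed (a ℕ.+ b) ⟩
    ℚᵘ.mkℚᵘ (+ (a ℕ.+ b)) 0                    ≈⟨ ℚᵘ.*≡* (cong (ℤ._* + 1) (sym (cong₂ ℤ._+_ (ℤ.*-identityʳ (+ a)) (ℤ.*-identityʳ (+ b))))) ⟩
    ℚᵘ.mkℚᵘ (+ a) 0 ℚᵘ.+ ℚᵘ.mkℚᵘ (+ b) 0       ≈⟨ ℚᵘ.+-cong (embed a) (embed b) ⟨
    toℚᵘ (ℕtoℚ a) ℚᵘ.+ toℚᵘ (ℕtoℚ b)           ≈⟨ toℚᵘ-homo-+ (ℕtoℚ a) (ℕtoℚ b) ⟨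
    toℚᵘ (ℕtoℚ a + ℕtoℚ b)                     ∎)
    where open ℚᵘ.≃-Reasoning

  ℕtoℚ-* : ∀ a b → ℕtoℚ (a ℕ.* b) ≡ ℕtoℚ a * ℕtoℚ b
  ℕtoℚ-* a b = toℚᵘ-injective (begin
    toℚᵘ (ℕtoℚ (a ℕ.* b))                      ≈⟨ embed (a ℕ.* b) ⟩
    ℚᵘ.mkℚᵘ (+ (a ℕ.* b)) 0                    ≈⟨ ℚᵘ.*≡* (cong (ℤ._* + 1) (ℤ.pos-* a b)) ⟩
    ℚᵘ.mkℚᵘ (+ a) 0 ℚᵘ.* ℚᵘ.mkℚᵘ (+ b) 0       ≈⟨ ℚᵘ.*-cong (embed a) (embed b) ⟨
    toℚᵘ (ℕtoℚ a) ℚᵘ.* toℚᵘ (ℕtoℚ b)           ≈⟨ toℚᵘ-homo-* (ℕtoℚ a) (ℕtoℚ b) ⟨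
    toℚᵘ (ℕtoℚ a * ℕtoℚ b)                     ∎)
    where open ℚᵘ.≃-Reasoning

  ℕtoℚ-mono : ∀ {a b} → a ℕ.≤ b → ℕtoℚ a ≤ ℕtoℚ b
  ℕtoℚ-mono {a} {b} a≤b = toℚᵘ-cancel-≤ (begin
    toℚᵘ (ℕtoℚ a)    ≃⟨ embed a ⟩
    ℚᵘ.mkℚᵘ (+ a) 0  ≤⟨ ℚᵘ.*≤* (ℤ.*-monoʳ-≤-nonNeg (+ 1) (ℤ.+≤+ a≤b)) ⟩
    ℚᵘ.mkℚᵘ (+ b) 0  ≃⟨ embed b ⟨
    toℚᵘ (ℕtoℚ b)    ∎)
    where open ℚᵘ.≤-Reasoning

  ℕtoℚ-nonNeg : ∀ k → NonNegative (ℕtoℚ k)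
  ℕtoℚ-nonNeg k = normalize-nonNeg k 1

  ℕtoℚ-pos : ∀ k .{{_ : ℕ.NonZero k}} → Positive (ℕtoℚ k)
  ℕtoℚ-pos k = normalize-pos k 1

  unit-fraction : ∀ r → ℕtoℚ (suc r) * ((+ 1) / suc r) ≡ 1ℚ
  unit-fraction r = toℚᵘ-injective (begin
    toℚᵘ (ℕtoℚ (suc r) * ((+ 1) / suc r))             ≈⟨ toℚᵘ-homo-* (ℕtoℚ (suc r)) ((+ 1) / suc r) ⟩
    toℚᵘ (ℕtoℚ (suc r)) ℚᵘ.* toℚᵘ ((+ 1) / suc r)     ≈⟨ ℚᵘ.*-cong (embed (suc r)) (toℚᵘ-fromℚᵘ (ℚᵘ.mkℚᵘ (+ 1) r)) ⟩
    ℚᵘ.mkℚᵘ (+ suc r) 0 ℚᵘ.* ℚᵘ.mkℚᵘ (+ 1) r          ≈⟨ ℚᵘ.*≡* (trans (ℤ.*-identityʳ _) (trans (ℤ.*-identityʳ (+ suc r)) (sym (trans (ℤ.*-identityˡ _) (cong +_ (ℕ.*-identityˡ (suc r))))))) ⟩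
    toℚᵘ 1ℚ                                           ∎)
    where open ℚᵘ.≃-Reasoning

  -- Transfers between ε m = `μ` and the pair of naturals given to the tester. Nonnegativity of `μ`
  -- ensures that the absolute value of the numerator loses nothing.
  module Fraction (μ : ℚ) (μ≥0 : 0ℚ ≤ μ) where
    num den : ℕ
    num = ℤ.∣ ↥ μ ∣
    den = ↧ₙ μ

    scaled : μ * ℕtoℚ den ≡ ℕtoℚ num
    scaled = toℚᵘ-injective (begin
      toℚᵘ (μ * ℕtoℚ den)             ≈⟨ toℚᵘ-homo-* μ (ℕtoℚ den) ⟩
      toℚᵘ μ ℚᵘ.* toℚᵘ (ℕtoℚ den)     ≈⟨ ℚᵘ.*-congˡ {toℚᵘ μ} (embed den) ⟩
      toℚᵘ μ ℚᵘ.* ℚᵘ.mkℚᵘ (+ den) 0   ≈⟨ cancel-den μ μ≥0 ⟩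
      ℚᵘ.mkℚᵘ (+ num) 0               ≈⟨ embed num ⟨
      toℚᵘ (ℕtoℚ num)                 ∎)
      where
      open ℚᵘ.≃-Reasoning
      cancel-den : ∀ μ → 0ℚ ≤ μ → toℚᵘ μ ℚᵘ.* ℚᵘ.mkℚᵘ (+ ↧ₙ μ) 0 ℚᵘ.≃ ℚᵘ.mkℚᵘ (+ ℤ.∣ ↥ μ ∣) 0
      cancel-den (mkℚ (+ a) d _) _ = ℚᵘ.*≡* (trans (ℤ.*-assoc (+ a) (+ suc d) (+ 1))
        (cong (λ x → + a ℤ.* x) (sym (ℤ.pos-* (suc d) 1))))
      cancel-den (mkℚ -[1+ a ] d _) μ≥0 with nonNegative μ≥0
      ... | ()

    private
      instance
        den≢0 : ℕ.NonZero den
        den≢0 = _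

    bound-by-< : ∀ e → μ < ℕtoℚ e → num ℕ.< e ℕ.* den
    bound-by-< e μ<e = ℕ.≰⇒> λ le → <-irrefl refl (<-≤-trans μ<e (*-cancelʳ-≤-pos (ℕtoℚ den) {{ℕtoℚ-pos den}} (begin
      ℕtoℚ e * ℕtoℚ den   ≡⟨ ℕtoℚ-* e den ⟨
      ℕtoℚ (e ℕ.* den)    ≤⟨ ℕtoℚ-mono le ⟩
      ℕtoℚ num            ≡⟨ scaled ⟨
      μ * ℕtoℚ den        ∎)))
      where open ≤-Reasoning

    cube-bound : ∀ x y → x ℕ.* (num ℕ.* num ℕ.* num) ℕ.≤ y ℕ.* (den ℕ.* den ℕ.* den) →
      ℕtoℚ x * (μ * μ * μ) ≤ ℕtoℚ y
    cube-bound x y le = *-cancelʳ-≤-pos (ℕtoℚ (den ℕ.* den ℕ.* den)) {{ℕtoℚ-pos _ {{den³≢0}}}} (begin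
      ℕtoℚ x * (μ * μ * μ) * ℕtoℚ (den ℕ.* den ℕ.* den)  ≡⟨ cong (ℕtoℚ x * (μ * μ * μ) *_) (cube den) ⟩
      ℕtoℚ x * (μ * μ * μ) * (δ * δ * δ)                 ≡⟨ rearrange (ℕtoℚ x) μ δ ⟩
      ℕtoℚ x * (μ * δ * (μ * δ) * (μ * δ))               ≡⟨ cong (λ z → ℕtoℚ x * (z * z * z)) scaled ⟩
      ℕtoℚ x * (ℕtoℚ num * ℕtoℚ num * ℕtoℚ num)          ≡⟨ cong (ℕtoℚ x *_) (cube num) ⟨
      ℕtoℚ x * ℕtoℚ (num ℕ.* num ℕ.* num)                ≡⟨ ℕtoℚ-* x _ ⟨
      ℕtoℚ (x ℕ.* (num ℕ.* num ℕ.* num))                 ≤⟨ ℕtoℚ-mono le ⟩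
      ℕtoℚ (y ℕ.* (den ℕ.* den ℕ.* den))                 ≡⟨ ℕtoℚ-* y _ ⟩
      ℕtoℚ y * ℕtoℚ (den ℕ.* den ℕ.* den)                ∎)
      where
      open ≤-Reasoning
      δ = ℕtoℚ den
      den³≢0 : ℕ.NonZero (den ℕ.* den ℕ.* den)
      den³≢0 = ℕ.m*n≢0 (den ℕ.* den) den {{ℕ.m*n≢0 den den}}
      cube : ∀ a → ℕtoℚ (a ℕ.* a ℕ.* a) ≡ ℕtoℚ a * ℕtoℚ a * ℕtoℚ a
      cube a = trans (ℕtoℚ-* (a ℕ.* a) a) (cong (_* ℕtoℚ a) (ℕtoℚ-* a a))
      rearrange : ∀ x m d → x * (m * m * m) * (d * d * d) ≡ x * (m * d * (m * d) * (m * d))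
      rearrange = solve 3 (λ x m d → x :* (m :* m :* m) :* (d :* d :* d) := x :* (m :* d :* (m :* d) :* (m :* d))) refl
        where open +-*-Solver

-- Decision trees: averaging, sequencing, repetition, reversal of edges

module Trees where

  open Sums
  open Rationals
  open import Data.Nat as ℕ using (ℕ; zero; suc)
  import Data.Nat.Properties as ℕ
  open import Data.Fin using (Fin; zero; suc)
  open import Data.Integer using (+_)
  open import Data.Maybe using (just; nothing)
  open import Data.Rational
  open import Data.Rational.Properties
  open import Data.Rational.Solver using (module +-*-Solver)
  open import Function using (_∘_)
  open import Relation.Binary.PropositionalEquality

  sumℚ-cong : ∀ r {p q : Fin r → ℚ} → (∀ i → p i ≡ q i) → sumℚ r p ≡ sumℚ r q
  sumℚ-cong zero    p≡q = refl
  sumℚ-cong (suc r) p≡q = cong₂ _+_ (p≡q zero) (sumℚ-cong r (p≡q ∘ suc))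

  sumℚ-nonNeg : ∀ r {p : Fin r → ℚ} → (∀ i → 0ℚ ≤ p i) → 0ℚ ≤ sumℚ r p
  sumℚ-nonNeg zero    p≥0 = ≤-refl
  sumℚ-nonNeg (suc r) p≥0 = +-mono-≤ (p≥0 zero) (sumℚ-nonNeg r (p≥0 ∘ suc))

  sumℚ-*ʳ : ∀ r q (p : Fin r → ℚ) → sumℚ r (λ i → p i * q) ≡ sumℚ r p * q
  sumℚ-*ʳ zero    q p = sym (*-zeroˡ q)
  sumℚ-*ʳ (suc r) q p = trans (cong (λ z → p zero * q + z) (sumℚ-*ʳ r q (p ∘ suc)))
    (sym (*-distribʳ-+ q (p zero) _))

  sumℚ-ones : ∀ r → sumℚ r (λ _ → 1ℚ) ≡ ℕtoℚ r
  sumℚ-ones zero    = refl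
  sumℚ-ones (suc r) = trans (cong (λ z → 1ℚ + z) (sumℚ-ones r)) (sym (ℕtoℚ-+ 1 r))

  sumℚ-bound : ∀ r c (p : Fin r → ℚ) (g : Fin r → ℕ) →
    (∀ i → ℕtoℚ c * p i ≤ ℕtoℚ (g i)) → ℕtoℚ c * sumℚ r p ≤ ℕtoℚ (sumℕ r g)
  sumℚ-bound zero    c p g p≤g = ≤-reflexive (*-zeroʳ (ℕtoℚ c))
  sumℚ-bound (suc r) c p g p≤g = begin
    ℕtoℚ c * (p zero + sumℚ r (p ∘ suc))               ≡⟨ *-distribˡ-+ (ℕtoℚ c) (p zero) _ ⟩
    ℕtoℚ c * p zero + ℕtoℚ c * sumℚ r (p ∘ suc)        ≤⟨ +-mono-≤ (p≤g zero) (sumℚ-bound r c _ _ (p≤g ∘ suc)) ⟩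
    ℕtoℚ (g zero) + ℕtoℚ (sumℕ r (g ∘ suc))            ≡⟨ ℕtoℚ-+ (g zero) _ ⟨
    ℕtoℚ (g zero ℕ.+ sumℕ r (g ∘ suc))                 ∎
    where open ≤-Reasoning

  module _ {n : ℕ} (G : Digraph n) where

    -- Averaging in denominator-free form: branch `i` may be charged any natural number `g i`
    -- bounding `c` times its acceptance probability, and only the mean charge counts.
    rand-bound : ∀ r (f : Fin (suc r) → Tree n) c t (g : Fin (suc r) → ℕ) →
      (∀ i → ℕtoℚ c * acceptProb G (f i) ≤ ℕtoℚ (g i)) → sumℕ (suc r) g ℕ.≤ suc r ℕ.* t →
      ℕtoℚ c * acceptProb G (rand r f) ≤ ℕtoℚ t
    rand-bound r f c t g p≤g total = *-cancelʳ-≤-pos (ℕtoℚ (suc r)) {{ℕtoℚ-pos (suc r)}} (begin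
      ℕtoℚ c * (S * ((+ 1) / suc r)) * ℕtoℚ (suc r)   ≡⟨ rearrange (ℕtoℚ c) S ((+ 1) / suc r) (ℕtoℚ (suc r)) ⟩
      ℕtoℚ c * S * (ℕtoℚ (suc r) * ((+ 1) / suc r))   ≡⟨ cong (ℕtoℚ c * S *_) (unit-fraction r) ⟩
      ℕtoℚ c * S * 1ℚ                                 ≡⟨ *-identityʳ _ ⟩
      ℕtoℚ c * S                                      ≤⟨ sumℚ-bound (suc r) c _ g p≤g ⟩
      ℕtoℚ (sumℕ (suc r) g)                           ≤⟨ ℕtoℚ-mono total ⟩
      ℕtoℚ (suc r ℕ.* t)                              ≡⟨ cong ℕtoℚ (ℕ.*-comm (suc r) t) ⟩
      ℕtoℚ (t ℕ.* suc r)                              ≡⟨ ℕtoℚ-* t (suc r) ⟩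
      ℕtoℚ t * ℕtoℚ (suc r)                           ∎)
      where
      open ≤-Reasoning
      S = sumℚ (suc r) (λ i → acceptProb G (f i))
      rearrange : ∀ c s i r → c * (s * i) * r ≡ c * s * (r * i)
      rearrange = solve 4 (λ c s i r → c :* (s :* i) :* r := c :* s :* (r :* i)) refl
        where open +-*-Solver

    rand-sure : ∀ r (f : Fin (suc r) → Tree n) → (∀ i → acceptProb G (f i) ≡ 1ℚ) →
      acceptProb G (rand r f) ≡ 1ℚ
    rand-sure r f sure = trans
      (cong (_* ((+ 1) / suc r)) (trans (sumℚ-cong (suc r) sure) (sumℚ-ones (suc r)))) (unit-fraction r)

    acceptProb-nonNeg : ∀ T → NonNegative (acceptProb G T)
    acceptProb-nonNeg accept     = _
    acceptProb-nonNeg reject     = _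
    acceptProb-nonNeg (rand r f) = nonNeg*nonNeg⇒nonNeg
      (sumℚ (suc r) λ i → acceptProb G (f i))
      {{nonNegative (sumℚ-nonNeg (suc r) λ i → nonNegative⁻¹ (acceptProb G (f i)) {{acceptProb-nonNeg (f i)}})}}
      ((+ 1) / suc r) {{normalize-nonNeg 1 (suc r)}}
    acceptProb-nonNeg (qOut v i f) = acceptProb-nonNeg (f _)
    acceptProb-nonNeg (qIn v i f)  = acceptProb-nonNeg (f _)

    acceptProb≤1 : ∀ T → acceptProb G T ≤ 1ℚ
    acceptProb≤1 accept       = ≤-refl
    acceptProb≤1 reject       = nonNegative⁻¹ 1ℚ
    acceptProb≤1 (rand r f)   = subst (_≤ 1ℚ) (*-identityˡ _)
      (rand-bound r f 1 1 (λ _ → 1) (λ i → subst (_≤ 1ℚ) (sym (*-identityˡ _)) (acceptProb≤1 (f i)))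
        (ℕ.≤-reflexive (sum-const (suc r) 1)))
    acceptProb≤1 (qOut v i f) = acceptProb≤1 (f _)
    acceptProb≤1 (qIn v i f)  = acceptProb≤1 (f _)

    scaled≤ : ∀ c T → ℕtoℚ c * acceptProb G T ≤ ℕtoℚ c
    scaled≤ c T = subst (ℕtoℚ c * acceptProb G T ≤_) (*-identityʳ (ℕtoℚ c))
      (*-monoˡ-≤-nonNeg (ℕtoℚ c) {{ℕtoℚ-nonNeg c}} (acceptProb≤1 T))

  maxℕ-lub : ∀ r {f : Fin r → ℕ} {c} → (∀ i → f i ℕ.≤ c) → maxℕ r f ℕ.≤ c
  maxℕ-lub zero    f≤c = ℕ.z≤n
  maxℕ-lub (suc r) f≤c = ℕ.⊔-lub (f≤c zero) (maxℕ-lub r (f≤c ∘ suc))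

  maxℕ-upper : ∀ r (f : Fin r → ℕ) i → f i ℕ.≤ maxℕ r f
  maxℕ-upper (suc r) f zero    = ℕ.m≤m⊔n _ _
  maxℕ-upper (suc r) f (suc i) = ℕ.≤-trans (maxℕ-upper r (f ∘ suc) i) (ℕ.m≤n⊔m _ _)

  maxℕ-cong : ∀ r {f g : Fin r → ℕ} → (∀ i → f i ≡ g i) → maxℕ r f ≡ maxℕ r g
  maxℕ-cong zero    f≡g = refl
  maxℕ-cong (suc r) f≡g = cong₂ ℕ._⊔_ (f≡g zero) (maxℕ-cong r (f≡g ∘ suc))

  -- Drawing from an empty range is not available in Tree; the value there is irrelevant.
  sample : ∀ {n} r → (Fin r → Tree n) → Tree n
  sample zero    _ = accept
  sample (suc r) f = rand r f

  sample-queries : ∀ {n} r (f : Fin r → Tree n) {q} → (∀ i → queries (f i) ℕ.≤ q) →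
    queries (sample r f) ℕ.≤ q
  sample-queries zero    f f≤q = ℕ.z≤n
  sample-queries (suc r) f f≤q = maxℕ-lub (suc r) f≤q

  sample-sure : ∀ {n} (G : Digraph n) r (f : Fin r → Tree n) →
    (∀ i → acceptProb G (f i) ≡ 1ℚ) → acceptProb G (sample r f) ≡ 1ℚ
  sample-sure G zero    f sure = refl
  sample-sure G (suc r) f sure = rand-sure G r f sure

  sample-bound : ∀ {n} (G : Digraph n) r (f : Fin r → Tree n) c t (g : Fin r → ℕ) → 0 ℕ.< r →
    (∀ i → ℕtoℚ c * acceptProb G (f i) ≤ ℕtoℚ (g i)) → sumℕ r g ℕ.≤ r ℕ.* t →
    ℕtoℚ c * acceptProb G (sample r f) ≤ ℕtoℚ t
  sample-bound G (suc r) f c t g _ = rand-bound G r f c t g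

  infixr 6 _then_
  _then_ : ∀ {n} → Tree n → Tree n → Tree n
  accept     then U = U
  reject     then U = reject
  rand r f   then U = rand r λ i → f i then U
  qOut v i f then U = qOut v i λ a → f a then U
  qIn v i f  then U = qIn v i λ a → f a then U

  -- A copy of `U` with fresh coins is grafted onto every accepting leaf of `T`, so the two runs are
  -- independent.
  acceptProb-then : ∀ {n} (G : Digraph n) T U →
    acceptProb G (T then U) ≡ acceptProb G T * acceptProb G U
  acceptProb-then G accept       U = sym (*-identityˡ _)
  acceptProb-then G reject       U = sym (*-zeroˡ (acceptProb G U))
  acceptProb-then G (rand r f)   U = begin
    sumℚ (suc r) (λ i → acceptProb G (f i then U)) * ((+ 1) / suc r)
      ≡⟨ cong (_* ((+ 1) / suc r)) (trans (sumℚ-cong (suc r) λ i → acceptProb-then G (f i) U)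
           (sumℚ-*ʳ (suc r) (acceptProb G U) λ i → acceptProb G (f i))) ⟩
    sumℚ (suc r) (λ i → acceptProb G (f i)) * acceptProb G U * ((+ 1) / suc r)
      ≡⟨ swap (sumℚ (suc r) λ i → acceptProb G (f i)) (acceptProb G U) ((+ 1) / suc r) ⟩
    sumℚ (suc r) (λ i → acceptProb G (f i)) * ((+ 1) / suc r) * acceptProb G U ∎
    where
    open ≡-Reasoning
    swap : ∀ a b c → a * b * c ≡ a * c * b
    swap = solve 3 (λ a b c → a :* b :* c := a :* c :* b) refl
      where open +-*-Solver
  acceptProb-then G (qOut v i f) U = acceptProb-then G (f _) U
  acceptProb-then G (qIn v i f)  U = acceptProb-then G (f _) U

  queries-then : ∀ {n} (T U : Tree n) → queries (T then U) ℕ.≤ queries T ℕ.+ queries U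
  queries-then accept     U = ℕ.≤-refl
  queries-then reject     U = ℕ.z≤n
  queries-then (rand r f) U = maxℕ-lub (suc r) λ i → ℕ.≤-trans (queries-then (f i) U)
    (ℕ.+-monoˡ-≤ (queries U) (maxℕ-upper (suc r) (λ i → queries (f i)) i))
  queries-then {n} (qOut v i f) U = ℕ.s≤s (ℕ.⊔-lub
    (ℕ.≤-trans (queries-then (f nothing) U) (ℕ.+-monoˡ-≤ (queries U) (ℕ.m≤m⊔n _ _)))
    (maxℕ-lub n λ w → ℕ.≤-trans (queries-then (f (just w)) U) (ℕ.+-monoˡ-≤ (queries U)
      (ℕ.≤-trans (maxℕ-upper n (λ w → queries (f (just w))) w) (ℕ.m≤n⊔m _ _)))))
  queries-then {n} (qIn v i f) U = ℕ.s≤s (ℕ.⊔-lub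
    (ℕ.≤-trans (queries-then (f nothing) U) (ℕ.+-monoˡ-≤ (queries U) (ℕ.m≤m⊔n _ _)))
    (maxℕ-lub n λ w → ℕ.≤-trans (queries-then (f (just w)) U) (ℕ.+-monoˡ-≤ (queries U)
      (ℕ.≤-trans (maxℕ-upper n (λ w → queries (f (just w))) w) (ℕ.m≤n⊔m _ _)))))

  then-sure : ∀ {n} (G : Digraph n) T U → acceptProb G T ≡ 1ℚ → acceptProb G U ≡ 1ℚ →
    acceptProb G (T then U) ≡ 1ℚ
  then-sure G T U t u = trans (acceptProb-then G T U) (cong₂ _*_ t u)

  repeat : ∀ {n} → ℕ → Tree n → Tree n
  repeat zero    T = accept
  repeat (suc j) T = T then repeat j T

  repeat-queries : ∀ {n} j (T : Tree n) → queries (repeat j T) ℕ.≤ j ℕ.* queries T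
  repeat-queries zero    T = ℕ.z≤n
  repeat-queries (suc j) T = ℕ.≤-trans (queries-then T (repeat j T))
    (ℕ.+-monoʳ-≤ (queries T) (repeat-queries j T))

  repeat-sure : ∀ {n} (G : Digraph n) j T → acceptProb G T ≡ 1ℚ → acceptProb G (repeat j T) ≡ 1ℚ
  repeat-sure G zero    T t = refl
  repeat-sure G (suc j) T t = then-sure G T (repeat j T) t (repeat-sure G j T t)

  -- Bernoulli's inequality in the form (1 - d/S)^j ≤ S/(S + dj).
  repeat-bound : ∀ {n} (G : Digraph n) T S d → d ℕ.≤ S →
    ℕtoℚ S * acceptProb G T ≤ ℕtoℚ (S ℕ.∸ d) →
    ∀ j → ℕtoℚ (S ℕ.+ j ℕ.* d) * acceptProb G (repeat j T) ≤ ℕtoℚ S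
  repeat-bound G T S d d≤S pT zero    = ≤-reflexive (trans (*-identityʳ _) (cong ℕtoℚ (ℕ.+-identityʳ S)))
  repeat-bound G T S d d≤S pT (suc j) = begin
    ℕtoℚ (S ℕ.+ suc j ℕ.* d) * acceptProb G (T then repeat j T)
      ≡⟨ cong (ℕtoℚ (S ℕ.+ suc j ℕ.* d) *_) (acceptProb-then G T (repeat j T)) ⟩
    ℕtoℚ (S ℕ.+ suc j ℕ.* d) * (p * q)
      ≡⟨ *-assoc (ℕtoℚ (S ℕ.+ suc j ℕ.* d)) p q ⟨
    ℕtoℚ (S ℕ.+ suc j ℕ.* d) * p * q
      ≤⟨ *-monoʳ-≤-nonNeg q {{acceptProb-nonNeg G (repeat j T)}} one-step ⟩
    ℕtoℚ (S ℕ.+ j ℕ.* d) * q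
      ≤⟨ repeat-bound G T S d d≤S pT j ⟩
    ℕtoℚ S ∎
    where
    open ≤-Reasoning
    p = acceptProb G T
    q = acceptProb G (repeat j T)
    one-step : ℕtoℚ (S ℕ.+ suc j ℕ.* d) * p ≤ ℕtoℚ (S ℕ.+ j ℕ.* d)
    one-step = begin
      ℕtoℚ (S ℕ.+ suc j ℕ.* d) * p                 ≡⟨ cong (_* p) (ℕtoℚ-+ S (suc j ℕ.* d)) ⟩
      (ℕtoℚ S + ℕtoℚ (suc j ℕ.* d)) * p            ≡⟨ *-distribʳ-+ p (ℕtoℚ S) _ ⟩
      -- The hypothesis on `p` is spent on the part `S`, where it gains `d`; on the rest `p ≤ 1` is
      -- used.
      ℕtoℚ S * p + ℕtoℚ (suc j ℕ.* d) * p          ≤⟨ +-mono-≤ pT (scaled≤ G (suc j ℕ.* d) T) ⟩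
      ℕtoℚ (S ℕ.∸ d) + ℕtoℚ (suc j ℕ.* d)          ≡⟨ ℕtoℚ-+ (S ℕ.∸ d) _ ⟨
      ℕtoℚ (S ℕ.∸ d ℕ.+ (d ℕ.+ j ℕ.* d))           ≡⟨ cong ℕtoℚ (trans (sym (ℕ.+-assoc (S ℕ.∸ d) d _))
                                                        (cong (ℕ._+ j ℕ.* d) (ℕ.m∸n+n≡m d≤S))) ⟩
      ℕtoℚ (S ℕ.+ j ℕ.* d)                         ∎

  transpose : ∀ {n} → Digraph n → Digraph n
  transpose G = record
    { adj = λ u w → adj G w u ; loopless = loopless G
    ; outList = inList G ; inList = outList G ; outUnique = inUnique G ; inUnique = outUnique G
    ; outComplete = inComplete G ; inComplete = outComplete G }

  -- A test for sets with few leaving edges becomes one for sets with few entering edges; its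
  -- analysis carries over from the transposed graph.
  flip : ∀ {n} → Tree n → Tree n
  flip accept       = accept
  flip reject       = reject
  flip (rand r f)   = rand r λ i → flip (f i)
  flip (qOut v i f) = qIn v i λ a → flip (f a)
  flip (qIn v i f)  = qOut v i λ a → flip (f a)

  acceptProb-flip : ∀ {n} (G : Digraph n) T → acceptProb G (flip T) ≡ acceptProb (transpose G) T
  acceptProb-flip G accept       = refl
  acceptProb-flip G reject       = refl
  acceptProb-flip G (rand r f)   = cong (_* ((+ 1) / suc r)) (sumℚ-cong (suc r) λ i → acceptProb-flip G (f i))
  acceptProb-flip G (qOut v i f) = acceptProb-flip G (f _)
  acceptProb-flip G (qIn v i f)  = acceptProb-flip G (f _)

  queries-flip : ∀ {n} (T : Tree n) → queries (flip T) ≡ queries T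
  queries-flip accept       = refl
  queries-flip reject       = refl
  queries-flip (rand r f)   = maxℕ-cong (suc r) λ i → queries-flip (f i)
  queries-flip {n} (qOut v i f) = cong suc (cong₂ ℕ._⊔_ (queries-flip (f nothing))
    (maxℕ-cong n λ w → queries-flip (f (just w))))
  queries-flip {n} (qIn v i f) = cong suc (cong₂ ℕ._⊔_ (queries-flip (f nothing))
    (maxℕ-cong n λ w → queries-flip (f (just w))))

-- Reading adjacency lists, and the exact test

module Reading where

  open Sums
  open Cuts
  open Trees
  open import Data.Nat
  open import Data.Nat.Properties
  open import Data.Bool using (Bool; true; false; _∧_; _∨_; not; if_then_else_)
  open import Data.Bool.Properties using (⇔→≡)
  open import Data.Empty using (⊥-elim)
  open import Data.Fin using (Fin; zero; suc)
  import Data.Fin.Properties as Fin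
  open import Data.List using (List; []; _∷_; length; allFin)
  open import Data.List.Membership.Propositional using (_∈_)
  open import Data.List.Membership.Propositional.Properties using (∈-allFin)
  open import Data.List.Properties using (length-tabulate)
  open import Data.List.Relation.Unary.All as All using ()
  open import Data.List.Relation.Unary.AllPairs using (_∷_)
  open import Data.List.Relation.Unary.Any using () renaming (here to hereᴸ; there to thereᴸ)
  open import Data.List.Relation.Unary.Unique.Propositional using (Unique)
  open import Data.Maybe using (Maybe; just; nothing; maybe′)
  open import Data.Product using (∃; _×_; _,_)
  open import Data.Rational using (ℚ; 1ℚ; 0ℚ)
  open import Data.Sum using (_⊎_; inj₁; inj₂; [_,_]′)
  open import Function using (_∘_)
  open import Function.Bundles using (Equivalence; mk⇔)
  open import Relation.Binary.PropositionalEquality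
  open import Relation.Nullary using (yes; no; ¬_; does)
  open import Relation.Nullary.Decidable using (dec-true; dec-false)

  Row : ℕ → Set
  Row n = Fin n → Bool

  -- Striking the head out of `p` lowers the sum by one and, as entries do not repeat, keeps the
  -- tail inside `p`.
  unique-length : ∀ {n} (xs : List (Fin n)) (p : Row n) → Unique xs →
    (∀ w → w ∈ xs → p w ≡ true) → length xs ≤ sumℕ n (b2n ∘ p)
  unique-length []       p _          _   = z≤n
  unique-length {n} (x ∷ xs) p (x∉ ∷ uniq) xs⊆p = ≤-<-trans
    (unique-length xs p′ uniq λ w w∈ → cong₂ (λ a b → a ∧ not b) (xs⊆p w (thereᴸ w∈))
      (dec-false (w Fin.≟ x) λ { refl → All.lookup x∉ w∈ refl }))
    (sum-mono-< n (λ w → b2n-mono ∧-trueˡ) x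
      (subst₂ (λ a b → b2n (a ∧ not b) < b2n a) (sym (xs⊆p x (hereᴸ refl))) (sym (dec-true (x Fin.≟ x) refl)) ≤-refl))
    where
    p′ : Row n
    p′ w = p w ∧ not (does (w Fin.≟ x))

  outdegree : ∀ {n} → EdgeRel n → Fin n → ℕ
  outdegree {n} E u = sumℕ n λ w → b2n (E u w)

  length≤outdegree : ∀ {n} (G : Digraph n) u → length (outList G u) ≤ outdegree (adj G) u
  length≤outdegree G u = unique-length (outList G u) (adj G u) (outUnique G u)
    λ w → Equivalence.to (outComplete G u w)

  outdegree≤n : ∀ {n} (E : EdgeRel n) u → outdegree E u ≤ n
  outdegree≤n {n} E u = ≤-trans (sum-mono n λ w → b2n≤1 (E u w))
    (≤-reflexive (trans (sum-const n 1) (*-identityʳ n)))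

  insert : ∀ {n} → Fin n → Row n → Row n
  insert w r x = does (x Fin.≟ w) ∨ r x

  -- readFrom D i u r c continues with nothing when the first D further entries
  -- of the list of u are all edges.
  readFrom : ∀ {n} → ℕ → ℕ → Fin n → Row n → (Maybe (Row n) → Tree n) → Tree n
  readFrom zero    i u r c = c nothing
  readFrom (suc D) i u r c = qOut u i λ
    { nothing → c (just r) ; (just w) → readFrom D (suc i) u (insert w r) c }

  readRow : ∀ {n} → ℕ → Fin n → (Maybe (Row n) → Tree n) → Tree n
  readRow D u = readFrom D 0 u λ _ → false

  readFrom-queries : ∀ {n} D i u (r : Row n) c {q} → (∀ a → queries (c a) ≤ q) →
    queries (readFrom D i u r c) ≤ D + q
  readFrom-queries zero    i u r c c≤q = c≤q nothing
  readFrom-queries {n} (suc D) i u r c c≤q = s≤s (⊔-lub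
    (≤-trans (c≤q (just r)) (m≤n+m _ D))
    (maxℕ-lub n λ w → readFrom-queries D (suc i) u (insert w r) c c≤q))

  readRow-queries : ∀ {n} D u (c : Maybe (Row n) → Tree n) {q} → (∀ a → queries (c a) ≤ q) →
    queries (readRow D u c) ≤ D + q
  readRow-queries D u = readFrom-queries D 0 u λ _ → false

  module _ {n : ℕ} (G : Digraph n) where

    Answer : ℕ → Fin n → Maybe (Row n) → Set
    Answer D u nothing  = D ≤ length (outList G u)
    Answer D u (just r) = ∀ w → r w ≡ adj G u w

    -- The loop invariant: `i` entries have been read, `r` records them, and `ys` is the unread rest
    -- of the list. The budget `D + i` is constant along the loop.
    readFrom-answer : ∀ D i u r c ys → (∀ j → nth (outList G u) (i + j) ≡ nth ys j) →
      i + length ys ≡ length (outList G u) →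
      (∀ w → w ∈ outList G u → r w ≡ true ⊎ w ∈ ys) →
      (∀ w → r w ≡ true ⊎ w ∈ ys → w ∈ outList G u) →
      ∃ λ a → Answer (D + i) u a × acceptProb G (readFrom D i u r c) ≡ acceptProb G (c a)
    readFrom-answer zero i u r c ys suffix len sound complete =
      nothing , ≤-trans (m≤m+n i _) (≤-reflexive len) , refl
    readFrom-answer (suc D) i u r c ys suffix len to from
      with nth (outList G u) i | trans (cong (nth (outList G u)) (sym (+-identityʳ i))) (suffix 0)
    readFrom-answer (suc D) i u r c [] suffix len to from | .nothing | refl =
      just r , (λ w → ⇔→≡ {z = true} (mk⇔
        (λ rw → Equivalence.to (outComplete G u w) (from w (inj₁ rw)))
        (λ uw → [ (λ rw → rw) , (λ ()) ]′ (to w (Equivalence.from (outComplete G u w) uw))))) , refl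
    readFrom-answer (suc D) i u r c (y ∷ ys) suffix len to from | .(just y) | refl =
      let (a , spec , eq) = readFrom-answer D (suc i) u (insert y r) c ys
            (λ j → trans (cong (nth (outList G u)) (sym (+-suc i j))) (suffix (suc j)))
            (trans (sym (+-suc i _)) len)
            to′ from′
      in a , subst (λ d → Answer d u a) (+-suc D i) spec , eq
      where
      to′ : ∀ w → w ∈ outList G u → insert y r w ≡ true ⊎ w ∈ ys
      to′ w w∈ with w Fin.≟ y | to w w∈
      ... | yes _  | _                  = inj₁ refl
      ... | no _   | inj₁ rw            = inj₁ rw
      ... | no w≢y | inj₂ (hereᴸ w≡y)   = ⊥-elim (w≢y w≡y)
      ... | no _   | inj₂ (thereᴸ w∈ys) = inj₂ w∈ys
      from′ : ∀ w → insert y r w ≡ true ⊎ w ∈ ys → w ∈ outList G u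
      from′ w (inj₂ w∈ys) = from w (inj₂ (thereᴸ w∈ys))
      from′ w (inj₁ rw) with w Fin.≟ y
      ... | yes w≡y = from w (inj₂ (hereᴸ w≡y))
      ... | no _    = from w (inj₁ rw)

    readRow-answer : ∀ D u c →
      ∃ λ a → Answer D u a × acceptProb G (readRow D u c) ≡ acceptProb G (c a)
    readRow-answer D u c with readFrom-answer D 0 u (λ _ → false) c (outList G u)
      (λ _ → refl) refl (λ w w∈ → inj₂ w∈) (λ { w (inj₂ w∈) → w∈ })
    ... | a , spec , eq = a , subst (λ d → Answer d u a) (+-identityʳ D) spec , eq

    readRow-elim : ∀ {ℓ} (P : ℚ → Set ℓ) D u c →
      (∀ a → Answer D u a → P (acceptProb G (c a))) → P (acceptProb G (readRow D u c))
    readRow-elim P D u c p = let (a , spec , eq) = readRow-answer D u c in subst P (sym eq) (p a spec)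

  setRow : ∀ {n} → Fin n → Row n → EdgeRel n → EdgeRel n
  setRow u r R x = if does (x Fin.≟ u) then r else R x

  module _ {n : ℕ} where

    -- A row has at most `n` entries, so a budget of `suc n` always meets ⊥; the default `accept` is
    -- never reached on an actual graph.
    readAll : List (Fin n) → EdgeRel n → (EdgeRel n → Tree n) → Tree n
    readAll []       R c = c R
    readAll (u ∷ us) R c = readRow (suc n) u
      (maybe′ (λ r → readAll us (setRow u r R) c) accept)

    readAll-queries : ∀ us R c → (∀ R → queries (c R) ≡ 0) → queries (readAll us R c) ≤ length us * suc n
    readAll-queries []       R c c≡0 = ≤-reflexive (c≡0 R)
    readAll-queries (u ∷ us) R c c≡0 = readRow-queries (suc n) u _ λ
      { nothing → z≤n ; (just r) → readAll-queries us (setRow u r R) c c≡0 }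

    readAll-answer : ∀ (G : Digraph n) us R c → (∀ u → u ∈ us ⊎ (∀ w → R u w ≡ adj G u w)) →
      ∃ λ R′ → (∀ u w → R′ u w ≡ adj G u w) × acceptProb G (readAll us R c) ≡ acceptProb G (c R′)
    readAll-answer G [] R c known = R , (λ u → [ (λ ()) , (λ eq → eq) ]′ (known u)) , refl
    readAll-answer G (u ∷ us) R c known with readRow-answer G (suc n) u
      (maybe′ (λ r → readAll us (setRow u r R) c) accept)
    ... | nothing , long , _ =
      ⊥-elim (<⇒≱ long (≤-trans (length≤outdegree G u) (outdegree≤n (adj G) u)))
    ... | just r , spec , eq =
      let (R′ , R′≡ , eq′) = readAll-answer G us (setRow u r R) c known′ in R′ , R′≡ , trans eq eq′
      where
      known′ : ∀ x → x ∈ us ⊎ (∀ w → setRow u r R x w ≡ adj G x w)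
      known′ x with x Fin.≟ u | known x
      ... | yes refl | _                 = inj₂ spec
      ... | no x≢u   | inj₁ (hereᴸ x≡u)  = ⊥-elim (x≢u x≡u)
      ... | no _     | inj₁ (thereᴸ x∈)  = inj₁ x∈
      ... | no _     | inj₂ eq           = inj₂ eq

    decide : ℕ → EdgeRel n → Tree n
    decide k R = if does (cuts≥? k R) then accept else reject

    exactTest : ℕ → Tree n
    exactTest k = readAll (allFin n) (λ _ _ → false) (decide k)

    exactTest-queries : ∀ k → queries (exactTest k) ≤ n * suc n
    exactTest-queries k = subst (λ l → queries (exactTest k) ≤ l * suc n) (length-tabulate {n = n} (λ i → i))
      (readAll-queries (allFin n) _ (decide k) no-queries)
      where
      no-queries : ∀ R → queries (decide k R) ≡ 0
      no-queries R with does (cuts≥? k R)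
      ... | true  = refl
      ... | false = refl

    exactTest-accepts : ∀ k (G : Digraph n) → Cuts≥ k (adj G) → acceptProb G (exactTest k) ≡ 1ℚ
    exactTest-accepts k G cuts with readAll-answer G (allFin n) (λ _ _ → false) (decide k) (inj₁ ∘ ∈-allFin)
    ... | R , R≡ , eq = trans eq (accepted (cuts≥-cong (λ u w → sym (R≡ u w)) cuts))
      where
      accepted : Cuts≥ k R → acceptProb G (decide k R) ≡ 1ℚ
      accepted ok rewrite dec-true (cuts≥? k R) ok = refl

    exactTest-rejects : ∀ k (G : Digraph n) → ¬ Cuts≥ k (adj G) → acceptProb G (exactTest k) ≡ 0ℚ
    exactTest-rejects k G bad with readAll-answer G (allFin n) (λ _ _ → false) (decide k) (inj₁ ∘ ∈-allFin)
    ... | R , R≡ , eq = trans eq (rejected λ ok → bad (cuts≥-cong R≡ ok))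
      where
      rejected : ¬ Cuts≥ k R → acceptProb G (decide k R) ≡ 0ℚ
      rejected bad rewrite dec-false (cuts≥? k R) bad = refl

-- Local search for a small violating set around a vertex

module LocalSearch where

  open Sums
  open Cuts
  open Rationals
  open Trees
  open Reading
  open import Data.Nat
  open import Data.Nat.Properties
  open import Data.Nat.Tactic.RingSolver using (solve-∀)
  open import Data.Bool using (true; false; _∧_; if_then_else_)
  open import Data.Bool.Properties using (¬-not) renaming (_≟_ to _≟ᵇ_)
  open import Data.Empty using (⊥-elim)
  open import Data.Fin using (Fin; zero; suc)
  import Data.Fin.Properties as Fin
  open import Data.Fin.Subset using (Subset; _∩_; _∪_)
  open import Data.Fin.Subset.Properties using (anySubset?)
  open import Data.List using (length)
  open import Data.Maybe using (Maybe; just; nothing)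
  open import Data.Product using (∃; _×_; _,_)
  open import Data.Rational as ℚ using (1ℚ)
  import Data.Rational.Properties as ℚ
  open import Data.Vec using ([]; _∷_)
  open import Function using (_∘_)
  open import Relation.Binary.PropositionalEquality
  open import Relation.Nullary using (Dec; yes; no; does)
  open import Relation.Nullary.Decidable using (_×-dec_; dec-true; decidable-stable)

  element : ∀ {n} (U : Subset n) → Fin (size U) → Fin n
  element (true  ∷ U) zero    = zero
  element (true  ∷ U) (suc i) = suc (element U i)
  element (false ∷ U) i       = suc (element U i)

  element-∈ : ∀ {n} (U : Subset n) i → U ! element U i ≡ true
  element-∈ (true  ∷ U) zero    = refl
  element-∈ (true  ∷ U) (suc i) = element-∈ U i
  element-∈ (false ∷ U) i       = element-∈ U i

  sum-elements : ∀ {n} (U : Subset n) (g : Fin n → ℕ) → sumℕ (size U) (g ∘ element U) ≤ sumℕ n g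
  sum-elements []          g = z≤n
  sum-elements (true  ∷ U) g = +-monoʳ-≤ (g zero) (sum-elements U (g ∘ suc))
  sum-elements (false ∷ U) g = ≤-trans (sum-elements U (g ∘ suc)) (m≤n+m _ (g zero))

  outsider : ∀ {n} (U : Subset n) → size U < n → ∃ λ w → U ! w ≡ false
  outsider {n} U small with Fin.any? (λ w → U ! w ≟ᵇ false)
  ... | yes w   = w
  ... | no none = ⊥-elim (<⇒≱ small (begin
    n                   ≡⟨ trans (sum-const n 1) (*-identityʳ n) ⟨
    sumℕ n (λ _ → 1)    ≤⟨ sum-mono n (λ w → ≤-reflexive (sym (cong b2n (¬-not λ w∉ → none (w , w∉))))) ⟩
    size U              ∎))
    where open ≤-Reasoning

  smallest : ∀ {n} {P : Subset n → Set} → (∀ X → Dec (P X)) → ∃ P →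
    ∃ λ U → P U × (∀ W → P W → size U ≤ size W)
  smallest {n} {P} P? (X , pX) = descend (size X) X pX ≤-refl
    where
    descend : ∀ b X → P X → size X ≤ b → ∃ λ U → P U × (∀ W → P W → size U ≤ size W)
    descend b X pX X≤b with anySubset? (λ W → P? W ×-dec (size W <? size X))
    ... | no none = X , pX , λ W pW → ≮⇒≥ λ W<X → none (W , pW , W<X)
    descend zero    X pX X≤b | yes (W , pW , W<X) = ⊥-elim (<⇒≱ W<X (≤-trans X≤b z≤n))
    descend (suc b) X pX X≤b | yes (W , pW , W<X) = descend b W pW (s≤s⁻¹ (≤-trans W<X X≤b))

  -- What has been learnt about the graph: row u is the out-neighbourhood of u
  -- once u is opened; sink u is the capacity of an artificial edge leaving u.
  record State (n : ℕ) : Set where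
    constructor state
    field
      opened : Row n
      row    : EdgeRel n
      sink   : Fin n → ℕ

  open State

  -- The out-cut in the known graph after attaching to each `u` a bundle of `sink st u` parallel
  -- edges to a point outside every `X`. The modular sink term preserves submodularity.
  load : ∀ {n} → State n → Subset n → ℕ
  load st X = weight (sink st) X + cut (row st) X

  load-submodular : ∀ {n} (st : State n) X Y → load st (X ∩ Y) + load st (X ∪ Y) ≤ load st X + load st Y
  load-submodular st X Y = begin
    load st (X ∩ Y) + load st (X ∪ Y)   ≡⟨ interchange (weight h (X ∩ Y)) (cut E (X ∩ Y)) _ _ ⟩
    (weight h (X ∩ Y) + weight h (X ∪ Y)) + (cut E (X ∩ Y) + cut E (X ∪ Y))
      ≤⟨ +-mono-≤ (≤-reflexive (weight-modular h X Y)) (cut-submodular E X Y) ⟩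
    (weight h X + weight h Y) + (cut E X + cut E Y) ≡⟨ interchange (weight h X) (weight h Y) _ _ ⟩
    load st X + load st Y ∎
    where
    open ≤-Reasoning
    h = sink st
    E = row st
    interchange : ∀ a b c d → a + b + (c + d) ≡ a + c + (b + d)
    interchange = solve-∀

  addSink : ∀ {n} → Fin n → State n → State n
  addSink t (state o R h) = state o R λ x → b2n (does (x Fin.≟ t)) + h x

  -- The answer nothing says that u has too many out-edges to lie in the set
  -- searched for; a sink of capacity k keeps it out of every certificate.
  recordAnswer : ∀ {n} → ℕ → Fin n → Maybe (Row n) → State n → State n
  recordAnswer k u (just r) (state o R h) = state (insert u o) (setRow u r R) h
  recordAnswer k u nothing  (state o R h) = state (insert u o) R λ x → (if does (x Fin.≟ u) then k else 0) + h x

  init : ∀ {n} → State n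
  init = state (λ _ → false) (λ _ _ → false) (λ _ → 0)

  module Search {n : ℕ} (k N D : ℕ) (v : Fin n) where

    Tight : State n → ℕ → Subset n → Set
    Tight st j W = W ! v ≡ true × load st W ≤ j

    tight? : ∀ st j W → Dec (Tight st j W)
    tight? st j W = (W ! v ≟ᵇ true) ×-dec (load st W ≤? j)

    Smallest : State n → ℕ → Subset n → Set
    Smallest st j U = Tight st j U × (∀ W → Tight st j W → size U ≤ size W)

    -- In `raise` no set around `v` has load `j` or less, so the lower bound increases without a
    -- random choice. `spread` and `probe` keep the evidence that `U` is least, on which the
    -- progress argument rests.
    data Next (st : State n) (j : ℕ) : Set where
      raise   : (∀ W → W ! v ≡ true → j < load st W) → Next st j
      spread  : ∀ U → Smallest st j U → N ≤ size U → Next st j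
      probe   : ∀ U → Smallest st j U → size U < N → ∀ u → U ! u ≡ true → opened st u ≡ false → Next st j
      certify : ∀ U → Tight st j U → size U < N → (∀ u → U ! u ≡ true → opened st u ≡ true) → Next st j

    next : ∀ st j → Next st j
    next st j with anySubset? (tight? st j)
    ... | no none = raise λ W v∈ → ≰⇒> λ tight → none (W , v∈ , tight)
    ... | yes some with smallest (tight? st j) some
    ...   | U , tight , least with N ≤? size U
    ...     | yes large = spread U (tight , least) large
    ...     | no small with Fin.any? (λ u → (U ! u ≟ᵇ true) ×-dec (opened st u ≟ᵇ false))
    ...       | yes (u , u∈ , closed) = probe U (tight , least) (≰⇒> small) u u∈ closed
    ...       | no none = certify U tight (≰⇒> small) λ u u∈ →
      decidable-stable (opened st u ≟ᵇ true) λ closed → none (u , u∈ , ¬-not closed)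

    -- search r j a: every set containing v has load at least j, the target load
    -- is j + r, and a bounds the vertices still to be opened before the next raise.
    search : (r j a : ℕ) → State n → Tree n
    act    : (r j a : ℕ) (st : State n) → Next st j → Tree n
    search r j a st = act r j a st (next st j)
    act zero    j a st _              = accept
    act (suc r) j a st (raise _)      = search r (suc j) N st
    act (suc r) j a st (spread U _ _) = sample (size U) λ i → search r (suc j) N (addSink (element U i) st)
    act (suc r) j a st (certify _ _ _ _) = reject
    -- While `Invariant` holds, exhausted fuel forces every tight set to have `N` vertices and this
    -- case cannot occur. Accepting here keeps the error one-sided.
    act (suc r) j zero    st (probe _ _ _ u _ _) = accept
    act (suc r) j (suc a) st (probe _ _ _ u _ _) =
      readRow D u λ ans → search (suc r) j a (recordAnswer k u ans st)

    search-queries : ∀ r j a st → queries (search r j a st) ≤ (a + r * N) * D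
    act-queries    : ∀ r j a st x → queries (act r j a st x) ≤ (a + r * N) * D
    search-queries r j a st = act-queries r j a st (next st j)
    act-queries zero    j a st _ = z≤n
    act-queries (suc r) j a st (raise _) =
      ≤-trans (search-queries r (suc j) N st) (*-monoˡ-≤ D (m≤n+m _ a))
    act-queries (suc r) j a st (spread U _ _) = ≤-trans
      (sample-queries (size U) _ λ i → search-queries r (suc j) N (addSink (element U i) st))
      (*-monoˡ-≤ D (m≤n+m _ a))
    act-queries (suc r) j a st (certify _ _ _ _) = z≤n
    act-queries (suc r) j zero    st (probe _ _ _ u _ _) = z≤n
    act-queries (suc r) j (suc a) st (probe _ _ _ u _ _) =
      readRow-queries D u _ λ ans → search-queries (suc r) j a (recordAnswer k u ans st)

    module _ (G : Digraph n) where

      -- Rows may be incomplete at an opened vertex only if its sink has capacity at least `k`; a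
      -- set of load below `k` contains no such vertex.
      record Sound (st : State n) : Set where
        field
          row-⊆ : ∀ u w → row st u w ≡ true → adj G u w ≡ true
          row-⊇ : ∀ u w → opened st u ≡ true → sink st u < k → adj G u w ≡ true → row st u w ≡ true

      open Sound

      init-sound : Sound init
      init-sound = record { row-⊆ = λ _ _ () ; row-⊇ = λ _ _ () }

      addSink-sound : ∀ t {st} → Sound st → Sound (addSink t st)
      addSink-sound t snd = record { row-⊆ = row-⊆ snd
        ; row-⊇ = λ u w o small → row-⊇ snd u w o (≤-<-trans (m≤n+m _ _) small) }

      recordAnswer-sound : ∀ u ans {st} → Answer G D u ans → Sound st → Sound (recordAnswer k u ans st)
      recordAnswer-sound u nothing {st} long snd = record { row-⊆ = row-⊆ snd ; row-⊇ = ⊇ }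
        where
        ⊇ : ∀ x w → insert u (opened st) x ≡ true → (if does (x Fin.≟ u) then k else 0) + sink st x < k →
          adj G x w ≡ true → row st x w ≡ true
        ⊇ x w o small e with x Fin.≟ u
        ... | yes _ = ⊥-elim (<⇒≱ small (m≤m+n k _))
        ... | no _  = row-⊇ snd x w o small e
      recordAnswer-sound u (just r) {st} spec snd = record { row-⊆ = ⊆ ; row-⊇ = ⊇ }
        where
        ⊆ : ∀ x w → setRow u r (row st) x w ≡ true → adj G x w ≡ true
        ⊆ x w e with x Fin.≟ u
        ... | yes refl = trans (sym (spec w)) e
        ... | no _     = row-⊆ snd x w e
        ⊇ : ∀ x w → insert u (opened st) x ≡ true → sink st x < k → adj G x w ≡ true →
          setRow u r (row st) x w ≡ true
        ⊇ x w o small e with x Fin.≟ u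
        ... | yes refl = trans (spec w) e
        ... | no _     = row-⊇ snd x w o small e

      -- Only a certificate rejects. It has fewer than `N ≤ n` vertices, hence is a proper set, and
      -- its rows are complete, so its true cut is at most its load, which is below `k`: a
      -- contradiction.
      search-accepts : Cuts≥ k (adj G) → N ≤ n → ∀ r j a st → r + j ≡ k → Sound st →
        acceptProb G (search r j a st) ≡ 1ℚ
      act-accepts    : Cuts≥ k (adj G) → N ≤ n → ∀ r j a st → r + j ≡ k → Sound st → ∀ x →
        acceptProb G (act r j a st x) ≡ 1ℚ
      search-accepts cuts N≤n r j a st r+j snd = act-accepts cuts N≤n r j a st r+j snd (next st j)
      act-accepts cuts N≤n zero    j a st r+j snd _ = refl
      act-accepts cuts N≤n (suc r) j a st r+j snd (raise _) = search-accepts cuts N≤n r (suc j) N st (trans (+-suc r j) r+j) snd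
      act-accepts cuts N≤n (suc r) j a st r+j snd (spread U _ _) = sample-sure G (size U) _ λ i →
        search-accepts cuts N≤n r (suc j) N _ (trans (+-suc r j) r+j) (addSink-sound (element U i) snd)
      act-accepts cuts N≤n (suc r) j a st r+j snd (certify U (v∈ , tight) small all-open) = ⊥-elim (<⇒≱ load<k (begin
        k                 ≤⟨ (let (w , w∉) = outsider U (<-≤-trans small N≤n) in cuts U v w v∈ w∉) ⟩
        cut (adj G) U     ≤⟨ cut-mono U (λ u w u∈ _ e → row-⊇ snd u w (all-open u u∈) (sink<k u u∈) e) ⟩
        cut (row st) U    ≤⟨ m≤n+m _ _ ⟩
        load st U         ∎))
        where
        open ≤-Reasoning
        load<k : load st U < k
        load<k = ≤-trans (s≤s (≤-trans tight (m≤n+m j r))) (≤-reflexive r+j)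
        sink<k : ∀ u → U ! u ≡ true → sink st u < k
        sink<k u u∈ = ≤-<-trans (begin
          sink st u                     ≡⟨ *-identityˡ _ ⟨
          1 * sink st u                 ≡⟨ cong (λ b → b2n b * sink st u) u∈ ⟨
          b2n (U ! u) * sink st u       ≤⟨ term≤sum n (λ u → b2n (U ! u) * sink st u) u ⟩
          weight (sink st) U            ≤⟨ m≤m+n _ _ ⟩
          load st U                     ∎) load<k
      act-accepts cuts N≤n (suc r) j zero    st r+j snd (probe _ _ _ u _ _) = refl
      act-accepts cuts N≤n (suc r) j (suc a) st r+j snd (probe _ _ _ u _ _) =
        readRow-elim G (_≡ 1ℚ) D u _ λ ans spec →
          search-accepts cuts N≤n (suc r) j a _ r+j (recordAnswer-sound u ans spec snd)

      module _ (s : ℕ) (N-large : 2 * k * s ≤ N) (N>0 : 0 < N)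
        (X : Subset n) (v∈X : X ! v ≡ true) (X-small : size X ≤ s) (X-cut : cut (adj G) X < k)
        (X-short : ∀ u → X ! u ≡ true → length (outList G u) < D) where

        known : State n → Subset n → ℕ
        known st W = sumℕ n λ u → b2n (W ! u ∧ opened st u)

        -- By `low` the tight sets are exactly the minimisers around `v`. By `fuel` each of them
        -- holds at least `N` minus `a` opened vertices. `clean` says that no sink has hit `X` so
        -- far; this is the event whose failure is charged to the random choices.
        record Invariant (st : State n) (j a : ℕ) : Set where
          field
            sound : Sound st
            low   : ∀ W → W ! v ≡ true → j ≤ load st W
            fuel  : ∀ W → Tight st j W → N ≤ a + known st W
            clean : ∀ u → X ! u ≡ true → sink st u ≡ 0

        open Invariant

        -- Tight sets are minimisers of the submodular load, hence closed under ∩.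
        smallest-⊆ : ∀ {st j a U W} → Invariant st j a → Smallest st j U → Tight st j W →
          ∀ u → U ! u ≡ true → W ! u ≡ true
        smallest-⊆ {st} {j} {U = U} {W} inv ((v∈U , tU) , least) (v∈W , tW) u u∈U =
          decidable-stable (W ! u ≟ᵇ true) λ u∉W → <⇒≱
            (size-mono-< {X = U ∩ W} {U} (λ x → ∩-elimˡ U W x) u
              (trans (∩-! U W u) (cong₂ _∧_ u∈U (¬-not u∉W))) u∈U)
            (least (U ∩ W) (∩-intro U W v v∈U v∈W , +-cancelʳ-≤ j _ _ (begin
              load st (U ∩ W) + j                ≤⟨ +-monoʳ-≤ _ (low inv (U ∪ W) (∪-introˡ U W v v∈U)) ⟩
              load st (U ∩ W) + load st (U ∪ W)  ≤⟨ load-submodular st U W ⟩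
              load st U + load st W              ≤⟨ +-mono-≤ tU tW ⟩
              j + j                              ∎)))
          where open ≤-Reasoning

        addSink-mono : ∀ t st W → load st W ≤ load (addSink t st) W
        addSink-mono t st W = +-monoˡ-≤ (cut (row st) W)
          (sum-mono n λ u → *-monoʳ-≤ (b2n (W ! u)) (m≤n+m (sink st u) _))

        addSink-∈ : ∀ t st W → W ! t ≡ true → load st W < load (addSink t st) W
        addSink-∈ t st W t∈ = +-monoˡ-< (cut (row st) W)
          (sum-mono-< n (λ u → *-monoʳ-≤ (b2n (W ! u)) (m≤n+m (sink st u) _)) t at-t)
          where
          at-t : b2n (W ! t) * sink st t < b2n (W ! t) * (b2n (does (t Fin.≟ t)) + sink st t)
          at-t rewrite t∈ | dec-true (t Fin.≟ t) refl = ≤-refl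

        recordAnswer-mono : ∀ u ans {st} → Answer G D u ans → Sound st → ∀ W →
          load st W ≤ load (recordAnswer k u ans st) W
        recordAnswer-mono u nothing  {st} spec snd W = +-monoˡ-≤ (cut (row st) W)
          (sum-mono n λ x → *-monoʳ-≤ (b2n (W ! x)) (m≤n+m (sink st x) _))
        recordAnswer-mono u (just r) {st} spec snd W = +-monoʳ-≤ (weight (sink st) W)
          (cut-mono W λ x w _ _ → larger x w)
          where
          larger : ∀ x w → row st x w ≡ true → setRow u r (row st) x w ≡ true
          larger x w e with x Fin.≟ u
          ... | yes refl = trans (spec w) (row-⊆ snd x w e)
          ... | no _     = e

        recordAnswer-clean : ∀ u ans {st} → Answer G D u ans → (∀ x → X ! x ≡ true → sink st x ≡ 0) →
          ∀ x → X ! x ≡ true → sink (recordAnswer k u ans st) x ≡ 0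
        recordAnswer-clean u (just r) spec cl = cl
        recordAnswer-clean u nothing  long cl x x∈ with x Fin.≟ u
        ... | yes refl = ⊥-elim (<⇒≱ (X-short x x∈) long)
        ... | no _     = cl x x∈

        known-grows : ∀ u ans st W → W ! u ≡ true → opened st u ≡ false →
          known st W < known (recordAnswer k u ans st) W
        known-grows u ans st W u∈ closed = sum-mono-< n (λ x → b2n-mono (kept ans x)) u (at-u ans)
          where
          kept : ∀ ans x → W ! x ∧ opened st x ≡ true → W ! x ∧ opened (recordAnswer k u ans st) x ≡ true
          kept (just _) x e with does (x Fin.≟ u)
          ... | true  = cong (_∧ true) (∧-trueˡ e)
          ... | false = e
          kept nothing x e with does (x Fin.≟ u)
          ... | true  = cong (_∧ true) (∧-trueˡ e)
          ... | false = e
          at-u : ∀ ans → b2n (W ! u ∧ opened st u) < b2n (W ! u ∧ opened (recordAnswer k u ans st) u)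
          at-u (just _) rewrite u∈ | closed | dec-true (u Fin.≟ u) refl = ≤-refl
          at-u nothing  rewrite u∈ | closed | dec-true (u Fin.≟ u) refl = ≤-refl

        known≤size : ∀ st W → known st W ≤ size W
        known≤size st W = sum-mono n λ u → b2n-mono ∧-trueˡ

        -- Without sinks in `X` its load counts only true edges leaving it. Hence `low` cannot reach
        -- `j = k` as long as `clean` holds.
        load-X : ∀ {st j a} → Invariant st j a → load st X < k
        load-X {st} inv = ≤-<-trans (begin
          weight (sink st) X + cut (row st) X  ≤⟨ +-mono-≤ (≤-reflexive no-sink) (cut-mono X λ u w _ _ → row-⊆ (sound inv) u w) ⟩
          cut (adj G) X                        ∎) X-cut
          where
          open ≤-Reasoning
          vanish : ∀ u b → X ! u ≡ b → b2n b * sink st u ≡ 0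
          vanish u false _ = refl
          vanish u true u∈ rewrite clean inv u u∈ = refl
          no-sink : weight (sink st) X ≡ 0
          no-sink = trans (sum-cong n λ u → vanish u (X ! u) refl) (sum-zero n)

        -- Loads only grow, so sets tight afterwards were tight before and contain the least one, in
        -- particular `u`. Each of them gains an opened vertex, which pays for the lost unit of
        -- fuel.
        probe-invariant : ∀ {st j a U} u ans → Invariant st j (suc a) → Smallest st j U →
          U ! u ≡ true → opened st u ≡ false → Answer G D u ans → Invariant (recordAnswer k u ans st) j a
        probe-invariant {st} {j} {a} {U} u ans inv sU u∈ closed spec = record
          { sound = recordAnswer-sound u ans spec (sound inv)
          ; low   = λ W v∈ → ≤-trans (low inv W v∈) (grow W)
          ; fuel  = λ W (v∈ , tight) → let tW = v∈ , ≤-trans (grow W) tight in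
              ≤-trans (fuel inv W tW) (≤-trans (≤-reflexive (sym (+-suc a _)))
                (+-monoʳ-≤ a (known-grows u ans st W (smallest-⊆ {U = U} {W} inv sU tW u u∈) closed)))
          ; clean = recordAnswer-clean u ans spec (clean inv)
          }
          where
          grow = recordAnswer-mono u ans spec (sound inv)

        -- The vertex `t` lies in every tight set, so a single sink raises all of them above `j`;
        -- the fuel is then renewed in full.
        spread-invariant : ∀ {st j a U} t → Invariant st j a → Smallest st j U →
          U ! t ≡ true → X ! t ≡ false → Invariant (addSink t st) (suc j) N
        spread-invariant {st} {j} {a} {U} t inv sU t∈U t∉X = record
          { sound = addSink-sound t (sound inv)
          ; low   = low′
          ; fuel  = λ W _ → m≤m+n N _
          ; clean = clean′
          }
          where
          low′ : ∀ W → W ! v ≡ true → j < load (addSink t st) W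
          low′ W v∈ with load st W ≤? j
          ... | yes tight = ≤-<-trans (low inv W v∈)
            (addSink-∈ t st W (smallest-⊆ {U = U} {W} inv sU (v∈ , tight) t t∈U))
          ... | no slack  = <-≤-trans (≰⇒> slack) (addSink-mono t st W)
          clean′ : ∀ u → X ! u ≡ true → sink (addSink t st) u ≡ 0
          clean′ u u∈ with u Fin.≟ t
          ... | yes refl = true≢false (trans (sym u∈) t∉X)
          ... | no _     = clean inv u u∈

        -- A union bound over the at most `r` random sinks still to come, each hitting `X` with
        -- probability at most 1/(2k). At the start `r = k` gives 1/2.
        search-rejects : ∀ r j a st → r + j ≡ k → Invariant st j a →
          ℕtoℚ (2 * k) ℚ.* acceptProb G (search r j a st) ℚ.≤ ℕtoℚ r
        act-rejects    : ∀ r j a st → r + j ≡ k → Invariant st j a → ∀ x →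
          ℕtoℚ (2 * k) ℚ.* acceptProb G (act r j a st x) ℚ.≤ ℕtoℚ r
        search-rejects r j a st r+j inv = act-rejects r j a st r+j inv (next st j)
        act-rejects zero    j a st refl inv _ = ⊥-elim (<⇒≱ (load-X inv) (low inv X v∈X))
        act-rejects (suc r) j a st r+j inv (raise above) = ℚ.≤-trans
          (search-rejects r (suc j) N st (trans (+-suc r j) r+j) record
            { sound = sound inv ; low = above ; fuel = λ W _ → m≤m+n N _ ; clean = clean inv })
          (ℕtoℚ-mono (n≤1+n r))
        act-rejects (suc r) j a st r+j inv (certify _ _ _ _) = ℚ.≤-trans (ℚ.≤-reflexive (ℚ.*-zeroʳ (ℕtoℚ (2 * k)))) (ℕtoℚ-mono {0} {suc r} z≤n)
        act-rejects (suc r) j a st r+j inv (spread U sU large) = sample-bound G (size U) _ (2 * k) (suc r) cost (<-≤-trans N>0 large) each total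
          where
          cost : Fin (size U) → ℕ
          -- A sink inside `X` is charged as certain acceptance. At most `s` vertices of `U` are of
          -- this kind, so they add at most `2 * k * s ≤ size U` in total, that is, one per vertex
          -- on average.
          cost i = r + 2 * k * b2n (X ! element U i)
          each : ∀ i → ℕtoℚ (2 * k) ℚ.* acceptProb G (search r (suc j) N (addSink (element U i) st)) ℚ.≤ ℕtoℚ (cost i)
          each i with X ! element U i in t∈
          ... | true  = ℚ.≤-trans (scaled≤ G (2 * k) (search r (suc j) N (addSink (element U i) st)))
            (ℕtoℚ-mono (≤-trans (≤-reflexive (sym (*-identityʳ (2 * k)))) (m≤n+m (2 * k * 1) r)))
          ... | false = ℚ.≤-trans
            (search-rejects r (suc j) N _ (trans (+-suc r j) r+j)
              (spread-invariant {U = U} (element U i) inv sU (element-∈ U i) t∈))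
            (ℕtoℚ-mono (m≤m+n r _))
          total : sumℕ (size U) cost ≤ size U * suc r
          total = begin
            sumℕ (size U) cost
              ≡⟨ trans (sum-+ (size U) _ _) (cong₂ _+_ (sum-const (size U) r) (sum-*ˡ (size U) (2 * k) _)) ⟩
            size U * r + 2 * k * sumℕ (size U) (λ i → b2n (X ! element U i))
              ≤⟨ +-monoʳ-≤ (size U * r) (*-monoʳ-≤ (2 * k)
                   (≤-trans (sum-elements U (λ u → b2n (X ! u))) X-small)) ⟩
            size U * r + 2 * k * s    ≤⟨ +-monoʳ-≤ (size U * r) (≤-trans N-large large) ⟩
            size U * r + size U       ≡⟨ trans (+-comm _ (size U)) (sym (*-suc (size U) r)) ⟩
            size U * suc r            ∎
            where open ≤-Reasoning
        act-rejects (suc r) j zero st r+j inv (probe U (tU , _) small u _ _) =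
          ⊥-elim (<⇒≱ small (≤-trans (fuel inv U tU) (known≤size st U)))
        act-rejects (suc r) j (suc a) st r+j inv (probe U sU small u u∈ closed) =
          readRow-elim G (λ p → ℕtoℚ (2 * k) ℚ.* p ℚ.≤ ℕtoℚ (suc r)) D u _ λ ans spec →
            search-rejects (suc r) j a _ r+j (probe-invariant {U = U} u ans inv sU u∈ closed spec)

-- Tests started from a single vertex

module VertexTests where

  open Sums
  open Cuts
  open Augmentation using (Hits)
  open Rationals
  open Trees
  open Reading
  open LocalSearch
  open import Data.Nat
  open import Data.Nat.Properties
  open import Data.Nat.Tactic.RingSolver using (solve-∀)
  open import Data.Bool using (true; false; not; if_then_else_)
  open import Data.Bool.Properties using () renaming (_≟_ to _≟ᵇ_)
  open import Data.Empty using (⊥; ⊥-elim)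
  open import Data.Fin as Fin using (Fin)
  import Data.Fin.Properties as Fin
  open import Data.Fin.Subset using (Subset) renaming (⊥ to ∅)
  open import Data.Fin.Subset.Properties using (anySubset?)
  open import Data.List using (length)
  open import Data.Maybe using (Maybe; just; nothing; maybe′)
  open import Data.Product using (∃; _×_; _,_)
  open import Data.Rational as ℚ using (ℚ; 1ℚ; 0ℚ)
  import Data.Rational.Properties as ℚ
  open import Data.Vec using (_[_]≔_)
  open import Data.Vec.Properties using (lookup∘update; lookup∘update′)
  open import Function using (_∘_)
  open import Relation.Binary.PropositionalEquality
  open import Relation.Nullary using (Dec; yes; no; ¬_; does)
  open import Relation.Nullary.Decidable using (_×-dec_; dec-true; dec-false)

  -- suspects E marks the vertices from which the test succeeds with probability
  -- at least 1/2; they meet every small violating set.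
  record VertexTest (n k s q : ℕ) : Set where
    field
      test         : Fin n → Tree n
      suspects     : EdgeRel n → Row n
      test-queries : ∀ v → queries (test v) ≤ q
      accepts      : ∀ G v → Cuts≥ k (adj G) → acceptProb G (test v) ≡ 1ℚ
      rejects      : ∀ G v → suspects (adj G) v ≡ true → ℕtoℚ 2 ℚ.* acceptProb G (test v) ℚ.≤ ℕtoℚ 1
      suspects-hit : ∀ E → Loopless E → Hits k s E (suspects E)

  dec-witness : ∀ {P : Set} (d : Dec P) → does d ≡ true → P
  dec-witness (yes p) _ = p

  split≤ : ∀ {n} (E : EdgeRel n) X u → X ! u ≡ true →
    ∀ w → b2n (E u w) ≤ b2n (X ! w) + b2n (leaves E X u w)
  split≤ E X u u∈ w rewrite u∈ with X ! w
  ... | true  = m≤n⇒m≤n+o _ (b2n≤1 (E u w))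
  ... | false = ≤-refl

  outdegree-split : ∀ {n} (E : EdgeRel n) X u → X ! u ≡ true →
    outdegree E u ≤ size X + sumℕ n (λ w → b2n (leaves E X u w))
  outdegree-split {n} E X u u∈ = ≤-trans (sum-mono n (split≤ E X u u∈)) (≤-reflexive (sum-+ n _ _))

  outdegree-split-< : ∀ {n} {E : EdgeRel n} → Loopless E → ∀ X u → X ! u ≡ true →
    outdegree E u < size X + sumℕ n (λ w → b2n (leaves E X u w))
  outdegree-split-< {n} {E} noloop X u u∈ = <-≤-trans
    (sum-mono-< n (split≤ E X u u∈) u at-u) (≤-reflexive (sum-+ n _ _))
    where
    at-u : b2n (E u u) < b2n (X ! u) + b2n (leaves E X u u)
    at-u rewrite noloop u | u∈ = ≤-refl

  outdegree<n : ∀ {n} {E : EdgeRel n} → Loopless E → ∀ v → outdegree E v < n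
  outdegree<n {n} {E} noloop v = <-≤-trans
    (sum-mono-< n {g = λ _ → 1} (λ w → b2n≤1 (E v w)) v (≤-reflexive (cong (suc ∘ b2n) (noloop v))))
    (≤-reflexive (trans (sum-const n 1) (*-identityʳ n)))

  cut-singleton : ∀ {n} (E : EdgeRel n) v → cut E (∅ [ v ]≔ true) ≤ outdegree E v
  cut-singleton {n} E v = ≤-trans
    (sum-mono-but-one n {g = λ _ → 0} (outdegree E v) v others
      (≤-trans (sum-mono n λ w → b2n-mono (∧-trueʳ {not ((∅ [ v ]≔ true) ! w)} ∘ ∧-trueʳ {(∅ [ v ]≔ true) ! v})) (m≤m+n _ 0)))
    (≤-reflexive (trans (cong (outdegree E v +_) (sum-zero n)) (+-identityʳ _)))
    where
    others : ∀ u → ¬ u ≡ v → sumℕ n (λ w → b2n (leaves E (∅ [ v ]≔ true) u w)) ≤ 0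
    others u u≢v rewrite lookup∘update′ u≢v (∅ {n}) true | ∅-! u = ≤-reflexive (sum-zero n)

  another : ∀ {n} → 1 < n → (v : Fin n) → ∃ λ w → ¬ w ≡ v
  another {suc (suc n)} _ v = Fin.punchIn v Fin.zero , Fin.punchInᵢ≢i v Fin.zero
  another {suc zero} (s≤s ()) v

  cuts⇒outdegree : ∀ {n k} {E : EdgeRel n} → 1 < n → Cuts≥ k E → ∀ v → k ≤ outdegree E v
  cuts⇒outdegree {E = E} n>1 cuts v = let (w , w≢v) = another n>1 v in ≤-trans
    (cuts (∅ [ v ]≔ true) v w (lookup∘update v ∅ true) (trans (lookup∘update′ w≢v ∅ true) (∅-! w)))
    (cut-singleton E v)

  -- A violating set X with at most k vertices contains a vertex of outdegree
  -- below k: otherwise |X|(k + 1) ≤ |X|² + cut E X.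
  low-degree-hits : ∀ {n k s} {E : EdgeRel n} → s ≤ k → Loopless E →
    Hits k s E (λ v → does (outdegree E v <? k))
  low-degree-hits {n} {k} {s} {E} s≤k noloop X u u∈ small X≤s
    with Fin.any? (λ x → (X ! x ≟ᵇ true) ×-dec (outdegree E x <? k))
  ... | yes (x , x∈ , low) = x , x∈ , dec-true (outdegree E x <? k) low
  ... | no none = ⊥-elim (impossible (size X) refl)
    where
    open ≤-Reasoning
    row-sum : Fin n → ℕ
    row-sum x = sumℕ n λ w → b2n (leaves E X x w)
    each : ∀ x b → X ! x ≡ b → b2n b * suc k ≤ b2n b * size X + row-sum x
    each x false _  = z≤n
    each x true  x∈ = begin
      1 * suc k                   ≡⟨ *-identityˡ _ ⟩
      suc k                       ≤⟨ ≤-<-trans (≮⇒≥ λ low → none (x , x∈ , low)) (outdegree-split-< noloop X x x∈) ⟩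
      size X + row-sum x          ≡⟨ cong (_+ row-sum x) (*-identityˡ _) ⟨
      1 * size X + row-sum x      ∎
    double-count : size X * suc k ≤ size X * size X + cut E X
    double-count = begin
      size X * suc k                                           ≡⟨ sum-*ʳ n (suc k) _ ⟨
      sumℕ n (λ x → b2n (X ! x) * suc k)                       ≤⟨ sum-mono n (λ x → each x (X ! x) refl) ⟩
      sumℕ n (λ x → b2n (X ! x) * size X + row-sum x)          ≡⟨ sum-+ n _ _ ⟩
      sumℕ n (λ x → b2n (X ! x) * size X) + cut E X            ≡⟨ cong (_+ cut E X) (sum-*ʳ n (size X) _) ⟩
      size X * size X + cut E X                                ∎
    impossible : ∀ a → size X ≡ a → ⊥
    impossible zero    eq = <⇒≢ (member⇒size>0 X u u∈) (sym eq)
    impossible (suc b) eq with m≤n⇒∃[o]m+o≡n (≤-trans X≤s s≤k)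
    -- With size b + 1 and k = size + d, the product size · (k + 1) exceeds size² + k by exactly b ·
    -- d, so the double count forces `k ≤ cut E X`.
    ... | d , size+d = <⇒≱ small (+-cancelˡ-≤ (size X * size X) _ _ (begin
      size X * size X + k          ≡⟨ cong₂ (λ a k → a * a + k) eq (trans (sym size+d) (cong (_+ d) eq)) ⟩
      suc b * suc b + (suc b + d)  ≤⟨ m≤m+n _ (b * d) ⟩
      suc b * suc b + (suc b + d) + b * d ≡⟨ identity b d ⟩
      suc b * suc (suc b + d)      ≡⟨ cong₂ (λ a k → a * suc k) eq (trans (sym size+d) (cong (_+ d) eq)) ⟨
      size X * suc k               ≤⟨ double-count ⟩
      size X * size X + cut E X    ∎))
      where
      identity : ∀ b d → suc b * suc b + (suc b + d) + b * d ≡ suc b * suc (suc b + d)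
      identity = solve-∀

  module _ {n : ℕ} (k : ℕ) where

    judge : Maybe (Row n) → Tree n
    judge = maybe′ (λ r → if does (sumℕ n (b2n ∘ r) <? k) then reject else accept) accept

    judge-queries : ∀ a → queries (judge a) ≤ 0
    judge-queries nothing  = z≤n
    judge-queries (just r) with does (sumℕ n (b2n ∘ r) <? k)
    ... | true  = z≤n
    ... | false = z≤n

    answer-degree : ∀ (G : Digraph n) v r → Answer G k v (just r) → sumℕ n (b2n ∘ r) ≡ outdegree (adj G) v
    answer-degree G v r spec = sum-cong n λ w → cong b2n (spec w)

    judge-accepts : ∀ (G : Digraph n) v → k ≤ outdegree (adj G) v → ∀ a → Answer G k v a →
      acceptProb G (judge a) ≡ 1ℚ
    judge-accepts G v high nothing  _ = refl
    judge-accepts G v high (just r) spec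
      rewrite dec-false (sumℕ n (b2n ∘ r) <? k) (≤⇒≯ (subst (k ≤_) (sym (answer-degree G v r spec)) high)) = refl

    judge-rejects : ∀ (G : Digraph n) v → outdegree (adj G) v < k → ∀ a → Answer G k v a →
      acceptProb G (judge a) ≡ 0ℚ
    judge-rejects G v low nothing long = ⊥-elim (<⇒≱ low (≤-trans long (length≤outdegree G v)))
    judge-rejects G v low (just r) spec
      rewrite dec-true (sumℕ n (b2n ∘ r) <? k) (subst (_< k) (sym (answer-degree G v r spec)) low) = refl

  zero≤ : ∀ {c t p} → p ≡ 0ℚ → ℕtoℚ c ℚ.* p ℚ.≤ ℕtoℚ t
  zero≤ {c} {t} refl = subst (ℚ._≤ ℕtoℚ t) (sym (ℚ.*-zeroʳ (ℕtoℚ c))) (ℕtoℚ-mono {0} {t} z≤n)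

  -- The local search costs of order k² s (s + k), which is not O(k² s²) when s is small against k;
  -- in that range `k` queries to one row replace it.
  degree-test : ∀ {n k s} → 1 < n → s ≤ k → VertexTest n k s k
  degree-test {n} {k} {s} n>1 s≤k = record
    { test         = λ v → readRow k v (judge k)
    ; suspects     = λ E v → does (outdegree E v <? k)
    ; test-queries = λ v → ≤-trans (readRow-queries k v (judge k) (judge-queries k)) (≤-reflexive (+-identityʳ k))
    ; accepts      = λ G v cuts → readRow-elim G (_≡ 1ℚ) k v (judge k)
        (judge-accepts k G v (cuts⇒outdegree n>1 cuts v))
    ; rejects      = λ G v suspect → zero≤ {2} {1} (readRow-elim G (_≡ 0ℚ) k v (judge k)
        (judge-rejects k G v (dec-witness (outdegree (adj G) v <? k) suspect)))
    ; suspects-hit = λ E → low-degree-hits s≤k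
    }

  local-test : ∀ {n k s} → 0 < k → 0 < s → 2 * k * s ≤ n →
    VertexTest n k s ((2 * k * s + k * (2 * k * s)) * (s + k))
  local-test {n} {k} {s} k>0 s>0 N≤n = record
    { test         = λ v → Search.search k N D v k 0 N init
    ; suspects     = λ E v → does (violator? E v)
    ; test-queries = λ v → Search.search-queries k N D v k 0 N init
    ; accepts      = λ G v cuts → Search.search-accepts k N D v G cuts N≤n k 0 N init (+-identityʳ k)
        (Search.init-sound k N D v G)
    ; rejects      = λ G v suspect → found G v (dec-witness (violator? (adj G) v) suspect)
    ; suspects-hit = λ E _ X u u∈ small X≤s → u , u∈ , dec-true (violator? E u) (X , u∈ , X≤s , small)
    }
    where
    N = 2 * k * s
    -- A vertex of a violating set has at most `s` neighbours inside it and fewer than `k` outside,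
    -- so a list with `D` entries shows that the vertex lies in no such set.
    D = s + k
    Violator : EdgeRel n → Fin n → Subset n → Set
    Violator E v X = X ! v ≡ true × size X ≤ s × cut E X < k
    violator? : ∀ E v → Dec (∃ (Violator E v))
    violator? E v = anySubset? λ X → (X ! v ≟ᵇ true) ×-dec (size X ≤? s) ×-dec (cut E X <? k)
    k≢0 = >-nonZero k>0
    N>0 : 0 < N
    N>0 = *-mono-≤ (*-mono-≤ (s≤s (z≤n {1})) k>0) s>0
    found : ∀ G v → ∃ (Violator (adj G) v) →
      ℕtoℚ 2 ℚ.* acceptProb G (Search.search k N D v k 0 N init) ℚ.≤ ℕtoℚ 1
    found G v (X , v∈ , X≤s , small) = ℚ.*-cancelˡ-≤-pos (ℕtoℚ k) {{ℕtoℚ-pos k {{k≢0}}}} (begin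
      ℕtoℚ k ℚ.* (ℕtoℚ 2 ℚ.* p)     ≡⟨ ℚ.*-assoc (ℕtoℚ k) (ℕtoℚ 2) p ⟨
      ℕtoℚ k ℚ.* ℕtoℚ 2 ℚ.* p       ≡⟨ cong (ℚ._* p) (trans (cong ℕtoℚ (*-comm 2 k)) (ℕtoℚ-* k 2)) ⟨
      ℕtoℚ (2 * k) ℚ.* p            ≤⟨ Search.search-rejects k N D v G s ≤-refl N>0 X v∈ X≤s small short k 0 N init
                                        (+-identityʳ k) fresh ⟩
      ℕtoℚ k                        ≡⟨ ℚ.*-identityʳ (ℕtoℚ k) ⟨
      ℕtoℚ k ℚ.* ℕtoℚ 1             ∎)
      where
      open ℚ.≤-Reasoning
      p = acceptProb G (Search.search k N D v k 0 N init)
      short : ∀ u → X ! u ≡ true → length (outList G u) < D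
      short u u∈ = ≤-<-trans (length≤outdegree G u) (≤-<-trans (outdegree-split (adj G) X u u∈)
        (+-mono-≤-< X≤s (≤-<-trans (term≤sum n (λ x → sumℕ n λ w → b2n (leaves (adj G) X x w)) u) small)))
      fresh = record
        { sound = Search.init-sound k N D v G ; low = λ _ _ → z≤n
        ; fuel = λ _ _ → m≤m+n N _ ; clean = λ _ _ → refl }

-- The tester: rounds, choice of parameters, query count

module Tester where

  open Sums
  open Cuts
  open Augmentation
  open Rationals
  open Trees
  open Reading
  open VertexTests
  open import Data.Nat
  open import Data.Nat.DivMod
  open import Data.Nat.Properties
  open import Data.Nat.Tactic.RingSolver using (solve-∀)
  open import Data.Bool using (true; false)
  open import Data.Empty using (⊥-elim)
  open import Data.Fin as Fin using (Fin)
  import Data.Integer as ℤ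
  open import Data.Product using (∃; _,_; proj₁; proj₂)
  open import Data.Rational as ℚ using (ℚ; 1ℚ)
  import Data.Rational.Properties as ℚ
  open import Function using (_∘_)
  open import Relation.Binary.PropositionalEquality
  open import Relation.Nullary using (Dec; yes; no; ¬_)

  ⅓ : ℚ
  ⅓ = (ℤ.+ 1) ℚ./ 3

  at-most-⅓ : ∀ c p → 0 < c → ℕtoℚ (c * 3) ℚ.* p ℚ.≤ ℕtoℚ c → p ℚ.≤ ⅓
  at-most-⅓ c p c>0 le = ℚ.*-cancelˡ-≤-pos (ℕtoℚ 3) (ℚ.*-cancelˡ-≤-pos (ℕtoℚ c) {{ℕtoℚ-pos c {{>-nonZero c>0}}}} (begin
    ℕtoℚ c ℚ.* (ℕtoℚ 3 ℚ.* p)   ≡⟨ ℚ.*-assoc (ℕtoℚ c) (ℕtoℚ 3) p ⟨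
    ℕtoℚ c ℚ.* ℕtoℚ 3 ℚ.* p     ≡⟨ cong (ℚ._* p) (ℕtoℚ-* c 3) ⟨
    ℕtoℚ (c * 3) ℚ.* p          ≤⟨ le ⟩
    ℕtoℚ c                      ≡⟨ ℚ.*-identityʳ (ℕtoℚ c) ⟨
    ℕtoℚ c ℚ.* 1ℚ               ∎))
    where open ℚ.≤-Reasoning

  module _ {n k s q : ℕ} (T : VertexTest n k s q) where

    open VertexTest T

    both : Fin n → Tree n
    both v = test v then flip (test v)

    round : Tree n
    round = sample n both

    round-queries : queries round ≤ q + q
    round-queries = sample-queries n both λ v → ≤-trans (queries-then (test v) (flip (test v)))
      (+-mono-≤ (test-queries v) (≤-trans (≤-reflexive (queries-flip (test v))) (test-queries v)))

    round-accepts : ∀ G → Cuts≥ k (adj G) → acceptProb G round ≡ 1ℚ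
    round-accepts G cuts = sample-sure G n both λ v → then-sure G (test v) (flip (test v))
      (accepts G v cuts)
      (trans (acceptProb-flip G (test v)) (accepts (transpose G) v (cuts≥-ᵀ {E = adj G} cuts)))

    module _ (G : Digraph n) where

      bad-out bad-in : Row n
      bad-out = suspects (adj G)
      bad-in  = suspects (adj G ᵀ)

      -- One of the two factors is at most 1/2 unless v is unsuspicious both ways.
      both-bound : ∀ v → ℕtoℚ 4 ℚ.* acceptProb G (both v) ℚ.≤ ℕtoℚ (4 ∸ (b2n (bad-out v) + b2n (bad-in v)))
      both-bound v = subst (λ p → ℕtoℚ 4 ℚ.* p ℚ.≤ ℕtoℚ (4 ∸ (b2n (bad-out v) + b2n (bad-in v)))) (sym (acceptProb-then G (test v) (flip (test v))))
        (cases (bad-out v) (bad-in v) refl refl)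
        where
        x = acceptProb G (test v)
        y = acceptProb G (flip (test v))
        half : ∀ p q .{{_ : ℚ.NonNegative q}} → ℕtoℚ 2 ℚ.* p ℚ.≤ ℕtoℚ 1 → q ℚ.≤ 1ℚ → ℕtoℚ 4 ℚ.* (p ℚ.* q) ℚ.≤ ℕtoℚ 2
        half p q p≤ q≤ = begin
          ℕtoℚ 4 ℚ.* (p ℚ.* q)                 ≡⟨ ℚ.*-assoc (ℕtoℚ 2 ℚ.* ℕtoℚ 2) p q ⟨
          ℕtoℚ 2 ℚ.* ℕtoℚ 2 ℚ.* p ℚ.* q        ≡⟨ cong (ℚ._* q) (ℚ.*-assoc (ℕtoℚ 2) (ℕtoℚ 2) p) ⟩
          ℕtoℚ 2 ℚ.* (ℕtoℚ 2 ℚ.* p) ℚ.* q      ≤⟨ ℚ.*-monoʳ-≤-nonNeg q (ℚ.*-monoˡ-≤-nonNeg (ℕtoℚ 2) p≤) ⟩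
          ℕtoℚ 2 ℚ.* ℕtoℚ 1 ℚ.* q              ≤⟨ ℚ.*-monoˡ-≤-nonNeg (ℕtoℚ 2 ℚ.* ℕtoℚ 1) q≤ ⟩
          ℕtoℚ 2 ℚ.* ℕtoℚ 1 ℚ.* 1ℚ             ∎
          where open ℚ.≤-Reasoning
        2≤ : ∀ b → 2 ≤ 4 ∸ (1 + b2n b)
        2≤ true  = ≤-refl
        2≤ false = n≤1+n 2
        cases : ∀ b c → bad-out v ≡ b → bad-in v ≡ c → ℕtoℚ 4 ℚ.* (x ℚ.* y) ℚ.≤ ℕtoℚ (4 ∸ (b2n b + b2n c))
        cases true c bo _ = ℚ.≤-trans
          (half x y {{acceptProb-nonNeg G (flip (test v))}} (rejects G v bo) (acceptProb≤1 G (flip (test v))))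
          (ℕtoℚ-mono (2≤ c))
        cases false true _ bi = subst (λ p → ℕtoℚ 4 ℚ.* p ℚ.≤ ℕtoℚ 3) (ℚ.*-comm y x) (ℚ.≤-trans
          (half y x {{acceptProb-nonNeg G (test v)}}
            (subst (λ p → ℕtoℚ 2 ℚ.* p ℚ.≤ ℕtoℚ 1) (sym (acceptProb-flip G (test v))) (rejects (transpose G) v bi))
            (acceptProb≤1 G (test v)))
          (ℕtoℚ-mono (n≤1+n 2)))
        cases false false _ _ = subst (λ p → ℕtoℚ 4 ℚ.* p ℚ.≤ ℕtoℚ 4)
          (acceptProb-then G (test v) (flip (test v))) (scaled≤ G 4 (both v))

      -- By `both-bound` a vertex rejects with probability at least a quarter of its number of
      -- suspicious directions. This number averages at least 4/s, so one round accepts with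
      -- probability at most 1 - 1/s.
      round-rejects : 0 < n → 4 * n ≤ s * (sumℕ n (b2n ∘ bad-out) + sumℕ n (b2n ∘ bad-in)) →
        ℕtoℚ (s * 4) ℚ.* acceptProb G round ℚ.≤ ℕtoℚ (s * 4 ∸ 4)
      round-rejects n>0 many = sample-bound G n both (s * 4) (s * 4 ∸ 4) (λ v → s * (4 ∸ count v)) n>0
        (λ v → begin
          ℕtoℚ (s * 4) ℚ.* acceptProb G (both v)        ≡⟨ cong (ℚ._* acceptProb G (both v)) (ℕtoℚ-* s 4) ⟩
          ℕtoℚ s ℚ.* ℕtoℚ 4 ℚ.* acceptProb G (both v)   ≡⟨ ℚ.*-assoc (ℕtoℚ s) (ℕtoℚ 4) _ ⟩
          ℕtoℚ s ℚ.* (ℕtoℚ 4 ℚ.* acceptProb G (both v)) ≤⟨ ℚ.*-monoˡ-≤-nonNeg (ℕtoℚ s) {{ℕtoℚ-nonNeg s}} (both-bound v) ⟩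
          ℕtoℚ s ℚ.* ℕtoℚ (4 ∸ count v)                 ≡⟨ ℕtoℚ-* s (4 ∸ count v) ⟨
          ℕtoℚ (s * (4 ∸ count v))                      ∎)
        (subst (sumℕ n (λ v → s * (4 ∸ count v)) ≤_) (sym (*-distribˡ-∸ n (s * 4) 4))
          (m+n≤o⇒m≤o∸n _ total))
        where
        open ℚ.≤-Reasoning
        count : Fin n → ℕ
        count v = b2n (bad-out v) + b2n (bad-in v)
        count≤4 : ∀ v → count v ≤ 4
        count≤4 v = ≤-trans (+-mono-≤ (b2n≤1 (bad-out v)) (b2n≤1 (bad-in v))) (m≤m+n 2 2)
        complement : ∀ v → s * (4 ∸ count v) + s * count v ≡ s * 4
        complement v = trans (sym (*-distribˡ-+ s _ _)) (cong (s *_) (m∸n+n≡m (count≤4 v)))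
        total : sumℕ n (λ v → s * (4 ∸ count v)) + n * 4 ≤ n * (s * 4)
        total = ≤-trans (+-monoʳ-≤ (sumℕ n λ v → s * (4 ∸ count v))
            (≤-trans (≤-reflexive (*-comm n 4)) (≤-trans many (≤-reflexive
              (trans (cong (s *_) (sym (sum-+ n _ _))) (sym (sum-*ˡ n s count)))))))
          (≤-reflexive (trans (sym (sum-+ n _ _)) (trans (sum-cong n complement) (sum-const n (s * 4)))))

    -- With S = 4s and d = 4 in `repeat-bound`, `2 * s` repetitions bound the acceptance probability
    -- by 4s/(4s + 8s) = 1/3.
    rounds : Tree n
    rounds = repeat (2 * s) round

    rounds-queries : queries rounds ≤ 2 * s * (q + q)
    rounds-queries = ≤-trans (repeat-queries (2 * s) round) (*-monoʳ-≤ (2 * s) round-queries)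

    rounds-accept : ∀ G → Cuts≥ k (adj G) → acceptProb G rounds ≡ 1ℚ
    rounds-accept G cuts = repeat-sure G (2 * s) round (round-accepts G cuts)

    rounds-reject : ∀ G → 0 < n → 0 < s →
      4 * n ≤ s * (sumℕ n (b2n ∘ bad-out G) + sumℕ n (b2n ∘ bad-in G)) → acceptProb G rounds ℚ.≤ ⅓
    rounds-reject G n>0 s>0 many = at-most-⅓ (s * 4) (acceptProb G rounds) (*-monoˡ-≤ 4 s>0 ⟨≤⟩ z<s)
      (subst (λ c → ℕtoℚ c ℚ.* acceptProb G rounds ℚ.≤ ℕtoℚ (s * 4)) (triple s)
        (repeat-bound G round (s * 4) 4 (*-monoˡ-≤ 4 s>0) (round-rejects G n>0 many) (2 * s)))
      where
      _⟨≤⟩_ : ∀ {a b} → a ≤ b → 0 < a → 0 < b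
      p ⟨≤⟩ pos = <-≤-trans pos p
      triple : ∀ s → s * 4 + 2 * s * 4 ≡ s * 4 * 3
      triple = solve-∀

  -- The parameter ε m is given as the fraction a / b.
  Far : ∀ {n} → ℕ → ℕ → ℕ → EdgeRel n → Set
  Far a b k E = ∀ E′ → Loopless E′ → KEdgeConnected k E′ → a < editDist E E′ * b

  -- There are 2s rounds of two tests with at most 8k²s² queries each, hence 32 k² s³ queries, and
  -- the choice of s ensures s · a ≤ 16 k n b.
  constant : ℕ
  constant = 32 * (16 * 16 * 16)

  -- Since ε d̄ = a/(b n), the field `cost` is the bound O(k⁵/(ε d̄)³) with its denominators
  -- multiplied out.
  record Tests (n k a b : ℕ) (T : Tree n) : Set where
    field
      cost    : queries T * (a * a * a) ≤ constant * k ^ 5 * n ^ 3 * (b * b * b)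
      accepts : ∀ G → Cuts≥ k (adj G) → acceptProb G T ≡ 1ℚ
      rejects : ∀ G → Far a b k (adj G) → acceptProb G T ℚ.≤ ⅓

  editDist-refl : ∀ {n} (E : EdgeRel n) → editDist E E ≡ 0
  editDist-refl {n} E = trans (sum²-cong n λ u w → xor-refl (E u w)) (trans (sum-cong n λ _ → sum-zero n) (sum-zero n))
    where
    xor-refl : ∀ e → b2n (xorB e e) ≡ 0
    xor-refl true  = refl
    xor-refl false = refl

  far⇒disconnected : ∀ {n k a b} (G : Digraph n) → Far a b k (adj G) → ¬ KEdgeConnected k (adj G)
  far⇒disconnected {a = a} {b} G far conn =
    <⇒≱ (subst (λ e → a < e * b) (editDist-refl (adj G)) (far (adj G) (loopless G) conn)) z≤n

  accept-tests : ∀ {n k a b} → (∀ (G : Digraph n) → ¬ Far a b k (adj G)) → Tests n k a b accept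
  accept-tests notFar = record { cost = z≤n ; accepts = λ _ _ → refl ; rejects = λ G far → ⊥-elim (notFar G far) }

  reject-tests : ∀ {n k a b} → (∀ (G : Digraph n) → ¬ Cuts≥ k (adj G)) → Tests n k a b reject
  reject-tests never = record
    { cost = z≤n ; accepts = λ G cuts → ⊥-elim (never G cuts) ; rejects = λ _ _ → ℚ.nonNegative⁻¹ ⅓ }

  small-connected : ∀ {n k} {E : EdgeRel n} → n ≤ 1 → KEdgeConnected k E
  small-connected {suc zero} _ F few Fin.zero Fin.zero = here
  small-connected {suc (suc n)} (s≤s ())

  square-suc : ∀ k → 0 < k → suc k * suc k ≤ 4 * (k * k)
  square-suc k k>0 = ≤-trans (*-mono-≤ double double) (≤-reflexive (identity k))
    where
    double : suc k ≤ 2 * k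
    double = ≤-trans (+-monoˡ-≤ k k>0) (≤-reflexive (cong (k +_) (sym (+-identityʳ k))))
    identity : ∀ k → 2 * k * (2 * k) ≡ 4 * (k * k)
    identity = solve-∀

  -- With s = 1 and every vertex suspected, the augmentation applies to any graph and costs at most
  -- 4kn + (k + 1)² ≤ 8kn edits. For larger ε m no graph is far, and accepting costs no query.
  never-far : ∀ {n k a b} → 0 < k → k < n → 8 * (k * n * b) ≤ a → ∀ (G : Digraph n) → ¬ Far a b k (adj G)
  never-far {n} {k} {a} {b} k>0 k<n large G far =
    let (F , noloop , conn , edits) = cheap-augmentation k 1 (adj G) all all k<n (loopless G) hit hit
    in <⇒≱ (far F noloop conn) (begin
      editDist (adj G) F * b   ≤⟨ *-monoˡ-≤ b (few (editDist (adj G) F) edits) ⟩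
      8 * (k * n) * b          ≡⟨ *-assoc 8 (k * n) b ⟩
      8 * (k * n * b)          ≤⟨ large ⟩
      a                        ∎)
    where
    open ≤-Reasoning
    all : Row n
    all _ = true
    hit : ∀ {E} → Hits k 1 E all
    hit X u u∈ _ _ = u , u∈ , refl
    count : sumℕ n (b2n ∘ all) ≡ n
    count = trans (sum-const n 1) (*-identityʳ n)
    few : ∀ e → 1 * e ≤ k * (1 * sumℕ n (b2n ∘ all) + n) + k * (1 * sumℕ n (b2n ∘ all) + n) + 1 * (suc k * suc k) →
      e ≤ 8 * (k * n)
    few e le = begin
      e        ≡⟨ *-identityˡ e ⟨
      1 * e    ≤⟨ le ⟩
      k * (1 * sumℕ n (b2n ∘ all) + n) + k * (1 * sumℕ n (b2n ∘ all) + n) + 1 * (suc k * suc k)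
               ≡⟨ cong (λ c → k * (1 * c + n) + k * (1 * c + n) + 1 * (suc k * suc k)) count ⟩
      k * (1 * n + n) + k * (1 * n + n) + 1 * (suc k * suc k)
               ≤⟨ +-monoʳ-≤ (k * (1 * n + n) + k * (1 * n + n)) (*-monoʳ-≤ 1
                    (≤-trans (square-suc k k>0) (*-monoʳ-≤ 4 (*-monoʳ-≤ k (<⇒≤ k<n))))) ⟩
      k * (1 * n + n) + k * (1 * n + n) + 1 * (4 * (k * n)) ≡⟨ identity k n ⟩
      8 * (k * n) ∎
      where
      identity : ∀ k n → k * (1 * n + n) + k * (1 * n + n) + 1 * (4 * (k * n)) ≡ 8 * (k * n)
      identity = solve-∀

  -- Reading everything takes about n² queries. Using the first bound on `a` twice and the second
  -- once turns n² a³ into a multiple of n² · k⁴ · k n · b³, which has the required exponents.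
  exact-tests : ∀ {n k a b} → 0 < n → a ≤ 32 * (k * k * b) → a ≤ 8 * (k * n * b) → Tests n k a b (exactTest k)
  exact-tests {n} {k} {a} {b} n>0 small₁ small₂ = record
    { cost = begin
        queries (exactTest {n} k) * (a * a * a)     ≤⟨ *-mono-≤ (exactTest-queries {n} k) (*-mono-≤ (*-mono-≤ small₁ small₁) small₂) ⟩
        n * suc n * (32 * (k * k * b) * (32 * (k * k * b)) * (8 * (k * n * b)))
          ≤⟨ *-monoˡ-≤ (32 * (k * k * b) * (32 * (k * k * b)) * (8 * (k * n * b))) (*-monoʳ-≤ n (+-monoˡ-≤ n n>0)) ⟩
        n * (n + n) * (32 * (k * k * b) * (32 * (k * k * b)) * (8 * (k * n * b)))
          ≡⟨ identity n k b 32 8 ⟩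
        2 * (32 * 32 * 8) * k ^ 5 * n ^ 3 * (b * b * b)
          ≤⟨ *-monoˡ-≤ (b * b * b) (*-monoˡ-≤ (n ^ 3) (*-monoˡ-≤ (k ^ 5) (≤ᵇ⇒≤ (2 * (32 * 32 * 8)) constant _))) ⟩
        constant * k ^ 5 * n ^ 3 * (b * b * b)      ∎
    ; accepts = exactTest-accepts k
    ; rejects = λ G far → ℚ.≤-trans
        (ℚ.≤-reflexive (exactTest-rejects k G λ cuts → far⇒disconnected G far (cuts⇒connected cuts)))
        (ℚ.nonNegative⁻¹ ⅓)
    }
    where
    open ≤-Reasoning
    identity : ∀ n k b c d → n * (n + n) * (c * (k * k * b) * (c * (k * k * b)) * (d * (k * n * b)))
      ≡ 2 * (c * c * d) * (k * (k * (k * (k * (k * 1))))) * (n * (n * (n * 1))) * (b * b * b)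
    identity = solve-∀

  module _ {n k s q a b : ℕ} (T : VertexTest n k s q) (k>0 : 0 < k) (k<n : k < n) (b>0 : 0 < b) (s>0 : 0 < s)
    (s-lower : 8 * (k * n * b) ≤ s * a) (s-upper : s * a ≤ 16 * (k * n * b)) (a-large : 32 * (k * k * b) ≤ a)
    (q-bound : q ≤ 8 * (k * k * (s * s))) where

    open VertexTest T using (suspects; suspects-hit)

    -- Comparing farness with the cost of augmentation bounds s a by k b s times the number of
    -- suspects plus two error terms: 2knb for large tight sets and 4sk²b for the hub. The constants
    -- 8 and 32 make each at most s a / 4, so the suspects account for half of s a, which is at
    -- least 4knb.
    many-suspects : ∀ G → Far a b k (adj G) →
      4 * n ≤ s * (sumℕ n (b2n ∘ bad-out T G) + sumℕ n (b2n ∘ bad-in T G))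
    many-suspects G far = *-cancelˡ-≤ (4 * (k * b)) {{>-nonZero (*-mono-≤ (s≤s (z≤n {3})) (*-mono-≤ k>0 b>0))}} (begin
      4 * (k * b) * (4 * n)    ≡⟨ regroup₁ k b n ⟩
      2 * (8 * (k * n * b))    ≤⟨ *-monoʳ-≤ 2 s-lower ⟩
      2 * (s * a)              ≤⟨ +-cancelʳ-≤ (s * a + s * a) _ _ core ⟩
      4 * (k * b) * (s * c)    ∎)
      where
      open ≤-Reasoning
      augmentation = cheap-augmentation k s (adj G) (bad-out T G) (bad-in T G) k<n (loopless G)
        (suspects-hit (adj G) (loopless G)) (suspects-hit (adj G ᵀ) (loopless G))
      F = proj₁ augmentation
      noloop = proj₁ (proj₂ augmentation)
      conn = proj₁ (proj₂ (proj₂ augmentation))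
      edits = proj₂ (proj₂ (proj₂ augmentation))
      p = sumℕ n (b2n ∘ bad-out T G)
      r = sumℕ n (b2n ∘ bad-in T G)
      c = p + r
      e = editDist (adj G) F
      regroup₁ : ∀ k b n → 4 * (k * b) * (4 * n) ≡ 2 * (8 * (k * n * b))
      regroup₁ = solve-∀
      regroup₂ : ∀ x → 2 * x + (x + x) ≡ 4 * x
      regroup₂ = solve-∀
      regroup₃ : ∀ s e b → s * (e * b) ≡ s * e * b
      regroup₃ = solve-∀
      regroup₄ : ∀ k s p r n b → 4 * ((k * (s * p + n) + k * (s * r + n) + s * (4 * (k * k))) * b) ≡
        4 * (k * b) * (s * (p + r)) + (8 * (k * n * b) + s * (16 * (k * k * b)))
      regroup₄ = solve-∀
      core : 2 * (s * a) + (s * a + s * a) ≤ 4 * (k * b) * (s * c) + (s * a + s * a)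
      core = begin
        2 * (s * a) + (s * a + s * a)  ≡⟨ regroup₂ (s * a) ⟩
        4 * (s * a)                    ≤⟨ *-monoʳ-≤ 4 (*-monoʳ-≤ s (<⇒≤ (far F noloop conn))) ⟩
        4 * (s * (e * b))              ≡⟨ cong (4 *_) (regroup₃ s e b) ⟩
        4 * (s * e * b)                ≤⟨ *-monoʳ-≤ 4 (*-monoˡ-≤ b (≤-trans edits
                                            (+-monoʳ-≤ (k * (s * p + n) + k * (s * r + n)) (*-monoʳ-≤ s (square-suc k k>0))))) ⟩
        4 * ((k * (s * p + n) + k * (s * r + n) + s * (4 * (k * k))) * b)   ≡⟨ regroup₄ k s p r n b ⟩
        4 * (k * b) * (s * c) + (8 * (k * n * b) + s * (16 * (k * k * b)))
          ≤⟨ +-monoʳ-≤ (4 * (k * b) * (s * c)) (+-mono-≤ s-lower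
               (*-monoʳ-≤ s (≤-trans (*-monoˡ-≤ (k * k * b) (m≤m+n 16 16)) a-large))) ⟩
        4 * (k * b) * (s * c) + (s * a + s * a) ∎

    rounds-tests : Tests n k a b (rounds T)
    rounds-tests = record
      { cost = begin
          queries (rounds T) * (a * a * a)
            ≤⟨ *-monoˡ-≤ (a * a * a) (≤-trans (rounds-queries T) (*-monoʳ-≤ (2 * s) (+-mono-≤ q-bound q-bound))) ⟩
          2 * s * (8 * (k * k * (s * s)) + 8 * (k * k * (s * s))) * (a * a * a)
            ≡⟨ regroup₅ k s a ⟩
          32 * (k * k) * (s * a * (s * a) * (s * a))
            ≤⟨ *-monoʳ-≤ (32 * (k * k)) (*-mono-≤ (*-mono-≤ s-upper s-upper) s-upper) ⟩
          32 * (k * k) * (16 * (k * n * b) * (16 * (k * n * b)) * (16 * (k * n * b)))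
            ≡⟨ regroup₆ k n b 32 16 ⟩
          constant * k ^ 5 * n ^ 3 * (b * b * b) ∎
      ; accepts = rounds-accept T
      ; rejects = λ G far → rounds-reject T G (≤-<-trans z≤n k<n) s>0 (many-suspects G far)
      }
      where
      open ≤-Reasoning
      regroup₅ : ∀ k s a → 2 * s * (8 * (k * k * (s * s)) + 8 * (k * k * (s * s))) * (a * a * a) ≡
        32 * (k * k) * (s * a * (s * a) * (s * a))
      regroup₅ = solve-∀
      regroup₆ : ∀ k n b c d → c * (k * k) * (d * (k * n * b) * (d * (k * n * b)) * (d * (k * n * b))) ≡
        c * (d * d * d) * (k * (k * (k * (k * (k * 1))))) * (n * (n * (n * 1))) * (b * b * b)
      regroup₆ = solve-∀

  sublinear-tester : ∀ n k a b → 0 < k → k < n → 1 < n → 0 < b → a ≤ 8 * (k * n * b) → 32 * (k * k * b) ≤ a →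
    ∃ (Tests n k a b)
  sublinear-tester n k a b k>0 k<n n>1 b>0 a-small a-large = choose (s ≤? k)
    where
    open ≤-Reasoning
    a>0 : 0 < a
    a>0 = <-≤-trans (*-mono-≤ (s≤s (z≤n {31})) (*-mono-≤ (*-mono-≤ k>0 k>0) b>0)) a-large
    instance
      a≢0 : NonZero a
      a≢0 = >-nonZero a>0
    M = 8 * (k * n * b)
    -- Rounding up strictly keeps s positive; as `a` is at most `M`, it at most doubles the product:
    -- M ≤ s a ≤ 2M.
    s = suc (M / a)
    lower : M ≤ s * a
    lower = begin
      M                       ≡⟨ m≡m%n+[m/n]*n M a ⟩
      M % a + M / a * a       ≤⟨ +-monoˡ-≤ (M / a * a) (<⇒≤ (m%n<n M a)) ⟩
      s * a                   ∎
    upper : s * a ≤ 16 * (k * n * b)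
    upper = begin
      a + M / a * a           ≤⟨ +-mono-≤ a-small (m/n*n≤m M a) ⟩
      M + M                   ≡⟨ double (k * n * b) ⟩
      16 * (k * n * b)        ∎
      where
      double : ∀ x → 8 * x + 8 * x ≡ 16 * x
      double = solve-∀
    -- The size threshold of the local search must not exceed `n`, so that its certificates are
    -- proper sets. Here the 32 in `a-large` is exactly 2 · 16.
    fits : 2 * k * s ≤ n
    fits = *-cancelʳ-≤ _ _ a (begin
      2 * k * s * a             ≡⟨ *-assoc (2 * k) s a ⟩
      2 * k * (s * a)           ≤⟨ *-monoʳ-≤ (2 * k) upper ⟩
      2 * k * (16 * (k * n * b)) ≡⟨ regroup k n b ⟩
      n * (32 * (k * k * b))    ≤⟨ *-monoʳ-≤ n a-large ⟩
      n * a                     ∎)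
      where
      regroup : ∀ k n b → 2 * k * (16 * (k * n * b)) ≡ n * (32 * (k * k * b))
      regroup = solve-∀
    choose : Dec (s ≤ k) → ∃ (Tests n k a b)
    choose (yes s≤k) = _ , rounds-tests (degree-test n>1 s≤k) k>0 k<n b>0 z<s lower upper a-large (begin
      k                      ≡⟨ trans (*-identityʳ _) (*-identityʳ k) ⟨
      k * 1 * 1              ≤⟨ *-mono-≤ (*-monoʳ-≤ k k>0) (*-mono-≤ (z<s {M / a}) (z<s {M / a})) ⟩
      k * k * (s * s)        ≤⟨ m≤n*m (k * k * (s * s)) 8 ⟩
      8 * (k * k * (s * s))  ∎)
    choose (no s≰k) = _ , rounds-tests (local-test k>0 z<s fits) k>0 k<n b>0 z<s lower upper a-large (begin
      (2 * k * s + k * (2 * k * s)) * (s + k)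
        ≤⟨ *-mono-≤ (+-monoˡ-≤ (k * (2 * k * s)) (m≤n*m (2 * k * s) k {{>-nonZero k>0}})) (+-monoʳ-≤ s (<⇒≤ (≰⇒> s≰k))) ⟩
      (k * (2 * k * s) + k * (2 * k * s)) * (s + s)  ≡⟨ regroup k s ⟩
      8 * (k * k * (s * s)) ∎)
      where
      regroup : ∀ k s → (k * (2 * k * s) + k * (2 * k * s)) * (s + s) ≡ 8 * (k * k * (s * s))
      regroup = solve-∀

  tester : ∀ n k a b → 0 < b → ∃ (Tests n k a b)
  -- The cost bound is zero for `k = 0`, and no set has fewer than zero edges, so every graph is
  -- 0-edge connected.
  tester n zero a b _ = accept , accept-tests λ G far → far⇒disconnected G far λ _ ()
  tester n k@(suc _) a b b>0 with n ≤? 1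
  ... | yes n≤1 = accept , accept-tests λ G far → far⇒disconnected G far (small-connected n≤1)
  ... | no n≰1 with n ≤? k
  -- In a loopless graph outdegrees are below `n`, hence below `k`, so no graph on these vertices
  -- has the property.
  ...   | yes n≤k = reject , reject-tests λ G cuts →
    let v = Fin.fromℕ< (<⇒≤ (≰⇒> n≰1)) in
    <⇒≱ (outdegree<n {E = adj G} (loopless G) v) (≤-trans n≤k (cuts⇒outdegree (≰⇒> n≰1) cuts v))
  ...   | no n≰k with 8 * (k * n * b) ≤? a
  ...     | yes large = accept , accept-tests (never-far z<s (≰⇒> n≰k) large)
  ...     | no ¬large with 32 * (k * k * b) ≤? a
  ...       | no small = exactTest k , exact-tests (<⇒≤ (≰⇒> n≰1)) (<⇒≤ (≰⇒> small)) (<⇒≤ (≰⇒> ¬large))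
  ...       | yes ok = sublinear-tester n k a b z<s (≰⇒> n≰k) (≰⇒> n≰1) b>0 (<⇒≤ (≰⇒> ¬large)) ok

-- Passage to rational ε

open Cuts using (connected⇒cuts)
open Rationals using (ℕtoℚ-nonNeg; module Fraction)
open Tester using (constant; tester; module Tests)
import Data.Integer as ℤ
import Data.Rational.Properties as ℚ
open import Data.Nat as ℕ using (ℕ; _^_)
open import Data.Product using (Σ; ∃; _×_; _,_; proj₁; proj₂)
open import Data.Integer using (+_)
open import Data.Rational as ℚ using (ℚ; 0ℚ; 1ℚ; _/_; _*_; _<_; _≤_)
open import Relation.Binary.PropositionalEquality using (_≡_; refl)

fraction-tester : ∀ n k (μ : ℚ) → ∃ (Tester.Tests n k ℤ.∣ ℚ.↥ μ ∣ (ℚ.↧ₙ μ))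
fraction-tester n k μ = tester n k ℤ.∣ ℚ.↥ μ ∣ (ℚ.↧ₙ μ) ℕ.z<s

theorem25 : Σ ((n m : ℕ) → ℚ → ℕ → Tree n) λ A →
    Σ ℕ λ C →
    (n m : ℕ) (ε : ℚ) (k : ℕ) → 0ℚ < ε →
    (ℕtoℚ (queries (A n m ε k)) * ((ε * ℕtoℚ m) * (ε * ℕtoℚ m) * (ε * ℕtoℚ m))
    ≤ ℕtoℚ (C ℕ.* k ^ 5 ℕ.* n ^ 3))
    × ((G : Digraph n) → edgeCount (adj G) ≡ m →
    (KEdgeConnected k (adj G) → acceptProb G (A n m ε k) ≡ 1ℚ)
    × (EpsFar ε k (adj G) → acceptProb G (A n m ε k) ≤ (+ 1) / 3))
theorem25 = (λ n m ε k → proj₁ (fraction-tester n k (ε * ℕtoℚ m))) , constant , correct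
  where
  correct : (n m : ℕ) (ε : ℚ) (k : ℕ) → 0ℚ < ε → _
  correct n m ε k ε>0 =
    cube-bound (queries (proj₁ (fraction-tester n k μ))) (constant ℕ.* k ^ 5 ℕ.* n ^ 3) cost ,
    λ { G refl → (λ conn → accepts G (connected⇒cuts conn)) ,
                 (λ far → rejects G λ E′ noloop conn → bound-by-< (editDist (adj G) E′) (far E′ noloop conn)) }
    where
    μ = ε * ℕtoℚ m
    μ≥0 : 0ℚ ≤ μ
    μ≥0 = ℚ.nonNegative⁻¹ μ {{ℚ.nonNeg*nonNeg⇒nonNeg ε {{ℚ.pos⇒nonNeg ε {{ℚ.positive ε>0}}}} (ℕtoℚ m) {{ℕtoℚ-nonNeg m}}}}
    open Fraction μ μ≥0
    open Tests (proj₂ (fraction-tester n k μ))
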